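{- Let $K\ge2$ be an integer and let $n\ge n_0(K)$. Then the number $N^{\sim_2}_K(n)$ of $\sim_2$-classes in $\{\mathtt a,\mathtt b\}^n$ of cardinality $K$ is $$N^{\sim_2}_K(n)=2\varepsilon_K\,(n-2\rho_K+1)+4\sum_{r=2}^{\rho_K-1}c_K(r).$$
   Context: For $u,w\in\{\mathtt a,\mathtt b\}^n$, $u\sim_2w$ iff $u$ and $w$ have the same number of letters $\mathtt a$ and $\binom{u}{\mathtt{ab}}=\binom{w}{\mathtt{ab}}$, where $\binom{w}{\mathtt{ab}}$ is the number of occurrences of $\mathtt{ab}$ as a scattered subword of $w$. Let $p(\xi)$ be the number of partitions of the integer $\xi\ge0$ and $p_{\le r}(\xi)$ the number of partitions of $\xi$ with at most $r$ parts. Set $\rho_K=\min\{\xi\ge0:p(\xi)>K\}$; $\varepsilon_K=1$ if $K$ is a value of $p$ and $\varepsilon_K=0$ otherwise. For $2\le r<\rho_K$ set $c_K(r)=\#\{\xi\ge0:p_{\le r}(\xi)=K\}$ and $\tau_K(r)=\max\{\xi\ge0:p_{\le r}(\xi)=K\}$, with $\tau_K(r)=-\infty$ when no such $\xi$ exists. Finally $$n_0(K)=\max\Bigl(2\rho_K-1,\ \max_{2\le r<\rho_K}\bigl(r+\tau_K(r)+1\bigr)\Bigr).$$ -}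

module Defs where

open import Data.Bool.Base using (if_then_else_)
open import Data.Fin.Base using (Fin; toℕ)
open import Data.Fin.Properties using (injective⇒≤; toℕ-injective; toℕ<n)
open import Data.List.Base
  using (List; []; _∷_; _++_; map; mapMaybe; filter; deduplicate; length; upTo)
open import Data.List.Extrema.Nat using (max)
open import Data.List.Membership.Propositional using (_∈_)
open import Data.List.Membership.Propositional.Properties
  using (∈-map⁺; ∈-map⁻; ∈-++⁺ˡ; ∈-++⁺ʳ; ∈-++⁻; ∈-filter⁺; ∈-filter⁻; ∈-upTo⁺)
open import Data.List.Membership.Setoid.Properties using (index-injective)
import Data.List.Properties as List
open import Data.List.Relation.Unary.All using (All; []; _∷_)
import Data.List.Relation.Unary.AllPairs as AllPairs
open import Data.List.Relation.Unary.Any using (here; there; index)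
open import Data.List.Relation.Unary.Linked using (Linked; []; [-]; _∷_; linked?)
open import Data.List.Relation.Unary.Unique.Propositional using (Unique)
open import Data.List.Relation.Unary.Unique.Propositional.Properties
  using (map⁺; ++⁺; filter⁺)
import Data.Maybe.Base as Maybe
open import Data.Maybe.Base using (Maybe; just; nothing)
open import Data.Nat.Base
open import Data.Nat.ListAction using (sum)
open import Data.Nat.Properties
open import Data.Product.Base using (∃; ∃-syntax; _×_; _,_; proj₁; proj₂)
open import Data.Sum.Base using (inj₁; inj₂)
import Data.Vec.Base as Vec
open import Data.Vec.Base using (Vec; []; _∷_)
open import Function.Bundles using (_⇔_; mk⇔)
open import Relation.Binary.Definitions using (DecidableEquality)
open import Relation.Binary.PropositionalEquality
open import Relation.Nullary using (Dec; does; yes; no; ¬_; contradiction)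
open import Relation.Nullary.Decidable using (map′; _×-dec_)
import Relation.Unary as Unary

------------------------------------------------------------------------
-- Words and 2-binomial equivalence

data Letter : Set where
  a b : Letter

infix 4 _≟ᴸ_ _∼₂_ _∼₂?_

_≟ᴸ_ : DecidableEquality Letter
a ≟ᴸ a = yes refl
a ≟ᴸ b = no λ()
b ≟ᴸ a = no λ()
b ≟ᴸ b = yes refl

Word : ℕ → Set
Word = Vec Letter

words : ∀ n → List (Word n)
words zero    = [] ∷ []
words (suc n) = map (a ∷_) (words n) ++ map (b ∷_) (words n)

-- One entry for each of the 2ⁿ sets of positions, so that a scattered
-- subword is listed once per occurrence.
subwords : ∀ {n} → Word n → List (List Letter)
subwords []      = [] ∷ []
subwords (x ∷ w) = map (x ∷_) (subwords w) ++ subwords w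

binom : ∀ {n} → Word n → List Letter → ℕ
binom w u = length (filter (λ v → List.≡-dec _≟ᴸ_ v u) (subwords w))

#a : ∀ {n} → Word n → ℕ
#a = Vec.count (_≟ᴸ a)

_∼₂_ : ∀ {n} → Word n → Word n → Set
u ∼₂ w = #a u ≡ #a w × binom u (a ∷ b ∷ []) ≡ binom w (a ∷ b ∷ [])

_∼₂?_ : ∀ {n} (u w : Word n) → Dec (u ∼₂ w)
u ∼₂? w = (#a u ≟ #a w) ×-dec (binom u (a ∷ b ∷ []) ≟ binom w (a ∷ b ∷ []))

classSize : ∀ {n} → Word n → ℕ
classSize {n} w = length (filter (w ∼₂?_) (words n))

-- `deduplicate` keeps exactly one representative of each class.
N : ℕ → ℕ → ℕ
N K n = length (filter (λ w → classSize w ≟ K) (deduplicate _∼₂?_ (words n)))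

------------------------------------------------------------------------
-- Partitions

IsPartition : ℕ → List ℕ → Set
IsPartition ξ ps = All (0 <_) ps × Linked _≥_ ps × sum ps ≡ ξ

incrementHead : List ℕ → List ℕ
incrementHead []       = []
incrementHead (x ∷ xs) = suc x ∷ xs

compositions : ℕ → List (List ℕ)
compositions 0             = [] ∷ []
compositions 1             = (1 ∷ []) ∷ []
compositions (suc (suc n)) =
  map (1 ∷_) (compositions (suc n)) ++ map incrementHead (compositions (suc n))

partitions : ℕ → List (List ℕ)
partitions ξ = filter (linked? _≥?_) (compositions ξ)

p : ℕ → ℕ
p ξ = length (partitions ξ)

p≤ : ℕ → ℕ → ℕ
p≤ r ξ = length (filter (λ ps → length ps ≤? r) (partitions ξ))

private

  Composition : ℕ → List ℕ → Set
  Composition n c = All (0 <_) c × sum c ≡ n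

  sound-incrementHead : ∀ {n} d → Composition (suc n) d →
                        Composition (suc (suc n)) (incrementHead d)
  sound-incrementHead (x ∷ xs) (_ ∷ pos , eq) = s≤s z≤n ∷ pos , cong suc eq

  sound-step : ∀ n → (∀ {c} → c ∈ compositions (suc n) → Composition (suc n) c) →
               ∀ {c} → c ∈ compositions (suc (suc n)) → Composition (suc (suc n)) c
  sound-step n ih c∈ with ∈-++⁻ (map (1 ∷_) (compositions (suc n))) c∈
  ... | inj₁ c∈₁ with ∈-map⁻ (1 ∷_) c∈₁
  ...   | d , d∈ , refl with ih d∈
  ...     | pos , eq = s≤s z≤n ∷ pos , cong suc eq
  sound-step n ih c∈ | inj₂ c∈₂ with ∈-map⁻ incrementHead c∈₂
  ... | d , d∈ , refl = sound-incrementHead d (ih d∈)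

  sound : ∀ n {c} → c ∈ compositions n → Composition n c
  sound 0 (here refl) = [] , refl
  sound 1 (here refl) = s≤s z≤n ∷ [] , refl
  sound (suc (suc n)) = sound-step n (sound (suc n))

  complete : ∀ n {c} → All (0 <_) c → sum c ≡ n → c ∈ compositions n
  complete 0 {[]} _ _ = here refl
  complete 0 {suc _ ∷ _} _ ()
  complete 0 {zero ∷ _} (() ∷ _) _
  complete 1 {suc zero ∷ []} _ _ = here refl
  complete 1 {suc zero ∷ zero ∷ _} (_ ∷ () ∷ _) _
  complete 1 {suc zero ∷ suc _ ∷ _} _ ()
  complete 1 {suc (suc _) ∷ _} _ ()
  complete 1 {zero ∷ _} (() ∷ _) _
  complete (suc (suc n)) {zero ∷ _} (() ∷ _) _
  complete (suc (suc n)) {suc zero ∷ c} (_ ∷ pos) eq =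
    ∈-++⁺ˡ (∈-map⁺ (1 ∷_) (complete (suc n) pos (suc-injective eq)))
  complete (suc (suc n)) {suc (suc x) ∷ c} (_ ∷ pos) eq =
    ∈-++⁺ʳ (map (1 ∷_) (compositions (suc n)))
      (∈-map⁺ incrementHead
        (complete (suc n) {suc x ∷ c} (s≤s z≤n ∷ pos) (suc-injective eq)))

  incrementHead-injective : ∀ {c d} → incrementHead c ≡ incrementHead d → c ≡ d
  incrementHead-injective {[]}    {[]}    _    = refl
  incrementHead-injective {_ ∷ _} {_ ∷ _} refl = refl

  unique : ∀ n → Unique (compositions n)
  unique 0 = [] AllPairs.∷ AllPairs.[]
  unique 1 = [] AllPairs.∷ AllPairs.[]
  unique (suc (suc n)) =
    ++⁺ (map⁺ List.∷-injectiveʳ (unique (suc n)))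
        (map⁺ incrementHead-injective (unique (suc n)))
        disjoint
    where
    disjoint : ∀ {c} → ¬ (c ∈ map (1 ∷_) (compositions (suc n))
                        × c ∈ map incrementHead (compositions (suc n)))
    disjoint (c∈₁ , c∈₂) with ∈-map⁻ (1 ∷_) c∈₁ | ∈-map⁻ incrementHead c∈₂
    ... | _ , _ , refl | zero ∷ _ , d∈ , refl with sound (suc n) d∈
    ...   | () ∷ _ , _

∈-partitions : ∀ {ξ ps} → ps ∈ partitions ξ ⇔ IsPartition ξ ps
∈-partitions {ξ} {ps} = mk⇔ to from
  where
  to : ps ∈ partitions ξ → IsPartition ξ ps
  to ps∈ with ∈-filter⁻ (linked? _≥?_) ps∈
  ... | c∈ , dec with sound ξ c∈
  ...   | pos , eq = pos , dec , eq

  from : IsPartition ξ ps → ps ∈ partitions ξ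
  from (pos , dec , eq) = ∈-filter⁺ (linked? _≥?_) (complete ξ pos eq) dec

partitions-unique : ∀ ξ → Unique (partitions ξ)
partitions-unique ξ = filter⁺ (linked? _≥?_) (unique ξ)

------------------------------------------------------------------------
-- Growth of p and p≤, which makes the searches below finite

private

  -- The partition ξ = (ξ − i) + i.
  twoParts : ℕ → ℕ → List ℕ
  twoParts zero    zero    = []
  twoParts (suc ξ) zero    = suc ξ ∷ []
  twoParts ξ       (suc i) = ξ ∸ suc i ∷ suc i ∷ []

  second : List ℕ → ℕ
  second (_ ∷ y ∷ _) = y
  second _           = 0

  second-twoParts : ∀ ξ i → second (twoParts ξ i) ≡ i
  second-twoParts zero    zero    = refl
  second-twoParts (suc ξ) zero    = refl
  second-twoParts zero    (suc i) = refl
  second-twoParts (suc ξ) (suc i) = refl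

  twoParts-length : ∀ ξ i → length (twoParts ξ i) ≤ 2
  twoParts-length zero    zero    = z≤n
  twoParts-length (suc ξ) zero    = s≤s z≤n
  twoParts-length zero    (suc i) = ≤-refl
  twoParts-length (suc ξ) (suc i) = ≤-refl

  twoParts-isPartition : ∀ ξ i → i + i ≤ ξ → IsPartition ξ (twoParts ξ i)
  twoParts-isPartition zero    zero    _  = [] , [] , refl
  twoParts-isPartition (suc ξ) zero    _  = s≤s z≤n ∷ [] , [-] , +-identityʳ (suc ξ)
  twoParts-isPartition (suc ξ) (suc i) le =
    ≤-trans (s≤s z≤n) j≤ ∷ s≤s z≤n ∷ [] , j≤ ∷ [-] ,
    trans (cong (suc ξ ∸ suc i +_) (+-identityʳ (suc i)))
          (m∸n+n≡m (≤-trans (m≤m+n (suc i) (suc i)) le))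
    where
    j≤ : suc i ≤ suc ξ ∸ suc i
    j≤ = subst (_≤ suc ξ ∸ suc i) (m+n∸n≡m (suc i) (suc i)) (∸-monoˡ-≤ (suc i) le)

p≤-lower : ∀ {r} ξ m → 2 ≤ r → m + m ≤ ξ → m < p≤ r ξ
p≤-lower {r} ξ m 2≤r m+m≤ξ = injective⇒≤ {f = λ i → index (mem i)} injective
  where
  short? : Unary.Decidable (λ (ps : List ℕ) → length ps ≤ r)
  short? ps = length ps ≤? r

  mem : ∀ (i : Fin (suc m)) → twoParts ξ (toℕ i) ∈ filter short? (partitions ξ)
  mem i = ∈-filter⁺ short?
    (∈-filter⁺ (linked? _≥?_) (complete ξ (proj₁ isP) (proj₂ (proj₂ isP))) (proj₁ (proj₂ isP)))
    (≤-trans (twoParts-length ξ (toℕ i)) 2≤r)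
    where
    i≤m = s≤s⁻¹ (toℕ<n i)
    isP = twoParts-isPartition ξ (toℕ i) (≤-trans (+-mono-≤ i≤m i≤m) m+m≤ξ)

  injective : ∀ {i j} → index (mem i) ≡ index (mem j) → i ≡ j
  injective {i} {j} eq = toℕ-injective
    (trans (sym (second-twoParts ξ (toℕ i)))
      (trans (cong second (index-injective (setoid _) (mem i) (mem j) eq))
        (second-twoParts ξ (toℕ j))))

p-lower : ∀ ξ m → m + m ≤ ξ → m < p ξ
p-lower ξ m le = ≤-trans (p≤-lower ξ m ≤-refl le)
  (List.length-filter (λ ps → length ps ≤? 2) (partitions ξ))

------------------------------------------------------------------------
-- The constants attached to K

IsLeast : (ℕ → Set) → ℕ → Set
IsLeast P m = P m × (∀ {k} → P k → m ≤ k)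

least : ∀ {P : ℕ → Set} → Unary.Decidable P → ∀ n → P n → ∃ (IsLeast P)
least P? n pn with P? 0
... | yes p0 = 0 , p0 , λ _ → z≤n
least P? zero    pn | no ¬p0 = contradiction pn ¬p0
least {P} P? (suc n) pn | no ¬p0 with least (λ k → P? (suc k)) n pn
... | m , pm , minimal = suc m , pm , minimal′
  where
  minimal′ : ∀ {k} → P k → suc m ≤ k
  minimal′ {zero}  pk = contradiction pk ¬p0
  minimal′ {suc k} pk = s≤s (minimal pk)

ρ-least : ∀ K → ∃ (IsLeast (λ ξ → p ξ > K))
ρ-least K = least (λ ξ → p ξ >? K) (K + K) (p-lower (K + K) K ≤-refl)

ρ : ℕ → ℕ
ρ K = proj₁ (ρ-least K)

value? : ∀ K → Dec (∃[ ξ ] p ξ ≡ K)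
value? K = map′
  (λ (ξ , _ , eq) → ξ , eq)
  (λ (ξ , eq) → ξ , ≰⇒> (λ le → <-irrefl (sym eq) (p-lower ξ K le)) , eq)
  (anyUpTo? (λ ξ → p ξ ≟ K) (K + K))

ε : ℕ → ℕ
ε K = if does (value? K) then 1 else 0

-- All ξ with p≤ r ξ ≡ K, provided 2 ≤ r; see ∈-solutions.
solutions : ℕ → ℕ → List ℕ
solutions K r = filter (λ ξ → p≤ r ξ ≟ K) (upTo (K + K))

∈-solutions : ∀ {K r ξ} → 2 ≤ r → ξ ∈ solutions K r ⇔ p≤ r ξ ≡ K
∈-solutions {K} {r} {ξ} 2≤r = mk⇔
  (λ ξ∈ → proj₂ (∈-filter⁻ (λ ζ → p≤ r ζ ≟ K) {xs = upTo (K + K)} ξ∈))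
  (λ eq → ∈-filter⁺ (λ ζ → p≤ r ζ ≟ K)
    (∈-upTo⁺ (≰⇒> (λ le → <-irrefl (sym eq) (p≤-lower ξ K 2≤r le)))) eq)

c : ℕ → ℕ → ℕ
c K r = length (solutions K r)

-- `nothing` stands for −∞.
τ : ℕ → ℕ → Maybe ℕ
τ K r with solutions K r
... | []     = nothing
... | ξ ∷ ξs = just (max ξ ξs)

-- The integers r with 2 ≤ r < ρ K.
range : ℕ → List ℕ
range K = map (2 +_) (upTo (ρ K ∸ 2))

-- `max x xs` is the maximum of x and all of xs; the terms equal to −∞
-- are dropped.  The subtraction is exact because p 0 ≡ 1 forces
-- ρ K ≥ 1 as soon as K ≥ 1.  For the same reason n₀ K ≤ n gives
-- 2 * ρ K ≤ n + 1, so that n + 1 ∸ 2 * ρ K is n − 2ρ + 1.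
n₀ : ℕ → ℕ
n₀ K = max (2 * ρ K ∸ 1)
           (mapMaybe (λ r → Maybe.map (λ t → r + t + 1) (τ K r)) (range K))

{-# OPTIONS --safe #-}

-- The class of a word with k letters a, m letters b and q occurrences of ab
-- has as many elements as there are partitions of q inside a k × m box, so
-- N K n counts the pairs (k , q) for which this coefficient of the Gaussian
-- binomial [n choose k] equals K.  Fix k ≤ m = n − k.  For q ≤ m the box
-- condition on the parts is void and the coefficient is p≤ k q.  The sequence
-- of coefficients is a palindrome, and for s ≤ m no coefficient between the
-- indices s and k m − s is smaller than the one at s (`plateau`).  Hence once
-- p≤ k s > K, all solutions lie below s or mirror such a solution.  For
-- k ≥ ρ one takes s = ρ, which leaves the solutions of p q = K, at most one;
-- for 2 ≤ k < ρ one takes s = m, where p≤ k m > K holds because n ≥ 2 K + 2,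
-- a consequence of the term r = 2 of n₀.
module Submission where

open import Defs
open import Data.Nat.Base using (ℕ; _+_; _*_; _∸_; _≤_)
open import Data.List.Base using (map)
open import Data.Nat.ListAction using (sum)
open import Relation.Binary.PropositionalEquality using (_≡_)

open import Data.Bool.Base using (if_then_else_; true; false)
open import Data.List.Base
  using (List; []; _∷_; _++_; filter; length; upTo; applyUpTo; mapMaybe; deduplicate)
open import Data.List.Extrema.Nat using (max; xs≤max; ⊥≤max)
open import Data.List.Membership.Propositional using (_∈_; find; lose)
open import Data.List.Membership.Propositional.Properties
  using (∈-++⁺ˡ; ∈-++⁺ʳ; ∈-++⁻; ∈-map⁺; ∈-map⁻; ∈-filter⁺; ∈-filter⁻; ∈-upTo⁺)
open import Data.List.Membership.Propositional.Properties.WithK using (unique∧set⇒bag)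
import Data.List.Membership.Setoid.Properties as Setoid
import Data.List.Properties as List
open import Data.List.Relation.Binary.BagAndSetEquality using (∼bag⇒↭)
open import Data.List.Relation.Binary.Permutation.Propositional.Properties using (↭-length)
open import Data.List.Relation.Unary.All as All using (All; []; _∷_)
import Data.List.Relation.Unary.All.Properties as All
open import Data.List.Relation.Unary.AllPairs using (AllPairs; []; _∷_)
import Data.List.Relation.Unary.AllPairs.Properties as AllPairs
open import Data.List.Relation.Unary.Any as Any using (here; there)
import Data.List.Relation.Unary.Any.Properties as Any
open import Data.List.Relation.Unary.Linked as Linked using (Linked; []; [-]; _∷_)
open import Data.List.Relation.Unary.Linked.Properties using (Linked⇒All)
import Data.List.Relation.Unary.Unique.DecSetoid.Properties as UniqueDecSetoid
open import Data.List.Relation.Unary.Unique.Propositional using (Unique)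
import Data.List.Relation.Unary.Unique.Propositional.Properties as Unique
import Data.Maybe.Base as Maybe
open import Data.Maybe.Base using (Maybe; just)
import Data.Maybe.Relation.Unary.Any as AnyMaybe
open import Data.Nat.Base hiding (ℕ; _+_; _*_; _∸_; _≤_)
open import Data.Nat.Properties
open import Data.Nat.Tactic.RingSolver using (solve-∀)
open import Data.Product.Base using (_×_; _,_; proj₁; proj₂; ∃-syntax)
open import Data.Sum.Base using (inj₁; inj₂)
open import Data.Vec.Base using ([]; _∷_)
open import Function.Base using (_∘_; flip)
open import Function.Bundles using (_⇔_; mk⇔; Equivalence)
open import Relation.Binary.Bundles using (DecSetoid)
open import Relation.Binary.Definitions using (tri<; tri≈; tri>)
open import Relation.Binary.PropositionalEquality hiding (_≡_)
open import Relation.Nullary using (Dec; does; yes; no; ¬_; contradiction)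
open import Relation.Nullary.Decidable using (_×-dec_)
import Relation.Unary as Unary

-- Gaussian binomial coefficients

-- Reduces a linear goal to one combined hypothesis `u ≤ v` and an identity for the ring solver; `s`
-- is the slack.
linear-≤ : ∀ {x y u v} s → u ≤ v → x + v + s ≡ y + u → x ≤ y
linear-≤ {x} {y} {u} {v} s u≤v eq = +-cancelʳ-≤ v x y
  (≤-trans (m≤m+n (x + v) s) (≤-trans (≤-reflexive eq) (+-monoʳ-≤ y u≤v)))

-- Comparison of an index with the shift `d`. The case `above` exposes the index as `d + q`, the
-- form in which `shift` cancels.
data Position (d : ℕ) : ℕ → Set where
  below : ∀ {q} → q < d → Position d q
  above : ∀ q → Position d (d + q)

position : ∀ d q → Position d q
position d q with ≤-total d q
... | inj₁ d≤q with m≤n⇒∃[o]m+o≡n d≤q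
...   | q′ , refl = above q′
position d q | inj₂ q≤d with m≤n⇒m<n∨m≡n q≤d
... | inj₁ q<d  = below q<d
... | inj₂ refl = subst (Position q) (+-identityʳ q) (above 0)

-- Coefficients of x ^ d times the power series with coefficients f.
shift : ℕ → (ℕ → ℕ) → ℕ → ℕ
shift zero    f q       = f q
shift (suc d) f zero    = 0
shift (suc d) f (suc q) = shift d f q

shift-above : ∀ d {f} q → shift d f (d + q) ≡ f q
shift-above zero    q = refl
shift-above (suc d) q = shift-above d q

shift-below : ∀ d {f} {q} → q < d → shift d f q ≡ 0
shift-below (suc d) {q = zero}  _         = refl
shift-below (suc d) {q = suc q} (s≤s q<d) = shift-below d q<d

shift-cong : ∀ d {f g} → (∀ q → f q ≡ g q) → ∀ q → shift d f q ≡ shift d g q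
shift-cong zero    f≗g q       = f≗g q
shift-cong (suc d) f≗g zero    = refl
shift-cong (suc d) f≗g (suc q) = shift-cong d f≗g q

shift-shift : ∀ d e {f} q → shift d (shift e f) q ≡ shift (d + e) f q
shift-shift zero    e q       = refl
shift-shift (suc d) e zero    = refl
shift-shift (suc d) e (suc q) = shift-shift d e q

shift-+ : ∀ d {f g} q → shift d (λ i → f i + g i) q ≡ shift d f q + shift d g q
shift-+ zero    q       = refl
shift-+ (suc d) zero    = refl
shift-+ (suc d) (suc q) = shift-+ d q

δ₀ : ℕ → ℕ
δ₀ zero    = 1
δ₀ (suc _) = 0

-- The q-th coefficient of the Gaussian binomial [k+m choose k], that is,
-- the number of partitions of q with at most k parts, all of them at most m.
gauss : ℕ → ℕ → ℕ → ℕ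
gauss zero    m       q = δ₀ q
gauss (suc k) zero    q = δ₀ q
gauss (suc k) (suc m) q = gauss (suc k) m q + shift (suc m) (gauss k (suc m)) q

-- The definition of `gauss` splits by whether a part `suc m` occurs; this recursion splits by
-- whether all `suc k` parts are positive, in which case 1 is taken from each. In the inductive step
-- both sides unfold to the same four terms, since `2 + m + suc k` equals `2 + k + suc m`.
gauss-dual : ∀ k m q →
  gauss (suc k) (suc m) q ≡ gauss k (suc m) q + shift (suc k) (gauss (suc k) m) q
gauss-dual zero zero q = refl
gauss-dual zero (suc m) q = begin
  gauss 1 (suc m) q + shift (2 + m) δ₀ q
    ≡⟨ cong (_+ shift (2 + m) δ₀ q) (gauss-dual 0 m q) ⟩
  δ₀ q + shift 1 (gauss 1 m) q + shift (2 + m) δ₀ q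
    ≡⟨ +-assoc (δ₀ q) _ _ ⟩
  δ₀ q + (shift 1 (gauss 1 m) q + shift (2 + m) δ₀ q)
    ≡⟨ cong (λ t → δ₀ q + (shift 1 (gauss 1 m) q + t)) (shift-shift 1 (suc m) q) ⟨
  δ₀ q + (shift 1 (gauss 1 m) q + shift 1 (shift (suc m) δ₀) q)
    ≡⟨ cong (δ₀ q +_) (shift-+ 1 q) ⟨
  δ₀ q + shift 1 (gauss 1 (suc m)) q ∎
  where open ≡-Reasoning
gauss-dual (suc k) zero q = begin
  δ₀ q + shift 1 (gauss (suc k) 1) q
    ≡⟨ cong (δ₀ q +_) (shift-cong 1 (gauss-dual k 0) q) ⟩
  δ₀ q + shift 1 (λ i → gauss k 1 i + shift (suc k) δ₀ i) q
    ≡⟨ cong (δ₀ q +_) (shift-+ 1 q) ⟩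
  δ₀ q + (shift 1 (gauss k 1) q + shift 1 (shift (suc k) δ₀) q)
    ≡⟨ +-assoc (δ₀ q) _ _ ⟨
  δ₀ q + shift 1 (gauss k 1) q + shift 1 (shift (suc k) δ₀) q
    ≡⟨ cong (δ₀ q + shift 1 (gauss k 1) q +_) (shift-shift 1 (suc k) q) ⟩
  gauss (suc k) 1 q + shift (2 + k) δ₀ q ∎
  where open ≡-Reasoning
gauss-dual (suc k) (suc m) q = begin
  gauss (2 + k) (suc m) q + shift (2 + m) (gauss (suc k) (2 + m)) q
    ≡⟨ cong₂ _+_ (gauss-dual (suc k) m q)
         (trans (shift-cong (2 + m) (gauss-dual k (suc m)) q)
                (shift-+ (2 + m) q)) ⟩
  (A + C) + (B + shift (2 + m) (shift (suc k) D) q)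
    ≡⟨ cong (λ t → (A + C) + (B + t)) (shift-shift (2 + m) (suc k) q) ⟩
  (A + C) + (B + shift (2 + m + suc k) D q)
    ≡⟨ cong (λ d → (A + C) + (B + shift d D q)) (exponent k m) ⟩
  (A + C) + (B + E)
    ≡⟨ interchange A B C E ⟩
  (A + B) + (C + E)
    ≡⟨ cong (λ t → (A + B) + (C + t)) (shift-shift (2 + k) (suc m) q) ⟨
  (A + B) + (C + shift (2 + k) (shift (suc m) D) q)
    ≡⟨ cong ((A + B) +_) (shift-+ (2 + k) q) ⟨
  gauss (suc k) (2 + m) q + shift (2 + k) (gauss (2 + k) (suc m)) q ∎
  where
  open ≡-Reasoning
  A = gauss (suc k) (suc m) q
  B = shift (2 + m) (gauss k (2 + m)) q
  C = shift (2 + k) (gauss (2 + k) m) q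
  D = gauss (suc k) (suc m)
  E = shift (2 + k + suc m) D q
  exponent : ∀ k m → 2 + m + suc k ≡ 2 + k + suc m
  exponent = solve-∀
  interchange : ∀ w x y z → (w + y) + (x + z) ≡ (w + x) + (y + z)
  interchange = solve-∀

-- Transposing the box exchanges the defining recursion with `gauss-dual`.
gauss-comm : ∀ k m q → gauss k m q ≡ gauss m k q
gauss-comm zero    zero    q = refl
gauss-comm zero    (suc m) q = refl
gauss-comm (suc k) zero    q = refl
gauss-comm (suc k) (suc m) q = begin
  gauss (suc k) m q + shift (suc m) (gauss k (suc m)) q
    ≡⟨ cong₂ _+_ (gauss-comm (suc k) m q) (shift-cong (suc m) (gauss-comm k (suc m)) q) ⟩
  gauss m (suc k) q + shift (suc m) (gauss (suc m) k) q
    ≡⟨ gauss-dual m k q ⟨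
  gauss (suc m) (suc k) q ∎
  where open ≡-Reasoning

-- The box has only `k * m` cells.
gauss-large : ∀ k m q → k * m < q → gauss k m q ≡ 0
gauss-large zero    m       (suc q) _ = refl
gauss-large (suc k) zero    (suc q) _ = refl
gauss-large (suc k) (suc m) q lt =
  cong₂ _+_ (gauss-large (suc k) m q (≤-<-trans (*-monoʳ-≤ (suc k) (n≤1+n m)) lt))
            (shifted (position (suc m) q) lt)
  where
  shifted : ∀ {q} → Position (suc m) q → suc k * suc m < q →
            shift (suc m) (gauss k (suc m)) q ≡ 0
  shifted (below q<) _ = shift-below (suc m) q<
  shifted (above q) lt = trans (shift-above (suc m) q)
    (gauss-large k (suc m) q (+-cancelˡ-< (suc m) _ _ lt))

-- Complements in the box. A partition with a part `suc m` has a complement with fewer than `suc k`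
-- parts, so the defining recursion at `q` matches `gauss-dual` at `q′` with the summands exchanged.
gauss-mirror : ∀ k m {q q′} → q + q′ ≡ k * m → gauss k m q ≡ gauss k m q′
gauss-mirror zero m {zero} {zero} _ = refl
gauss-mirror (suc k) zero {zero} {zero} _ = refl
gauss-mirror (suc k) zero {zero} {suc q′} eq with trans eq (*-zeroʳ k)
... | ()
gauss-mirror (suc k) zero {suc q} eq with trans eq (*-zeroʳ k)
... | ()
gauss-mirror (suc k) (suc m) {q} {q′} eq = begin
  gauss (suc k) m q + shift (suc m) (gauss k (suc m)) q
    ≡⟨ +-comm (gauss (suc k) m q) _ ⟩
  shift (suc m) (gauss k (suc m)) q + gauss (suc k) m q
    ≡⟨ cong₂ _+_ (column (position (suc m) q) eq)
                 (sym (row (position (suc k) q′) (trans (+-comm q′ q) eq))) ⟩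
  gauss k (suc m) q′ + shift (suc k) (gauss (suc k) m) q′
    ≡⟨ gauss-dual k m q′ ⟨
  gauss (suc k) (suc m) q′ ∎
  where
  open ≡-Reasoning
  column : ∀ {q q′} → Position (suc m) q → q + q′ ≡ suc k * suc m →
           shift (suc m) (gauss k (suc m)) q ≡ gauss k (suc m) q′
  -- Here `q′` exceeds the area `k * suc m`, so both sides vanish.
  column {q} {q′} (below q<) eq = trans (shift-below (suc m) q<)
    (sym (gauss-large k (suc m) q′
      (linear-≤ 0 (+-mono-≤ q< (≤-reflexive (sym eq))) (column-total k m q q′))))
    where
    column-total : ∀ k m q q′ → suc (k * suc m) + (suc m + (q + q′)) + 0 ≡ q′ + (suc q + suc k * suc m)
    column-total = solve-∀
  column {q′ = q′} (above q) eq = trans (shift-above (suc m) q)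
    (gauss-mirror k (suc m)
      (+-cancelˡ-≡ (suc m) _ _ (trans (sym (+-assoc (suc m) q q′)) eq)))

  row : ∀ {q q′} → Position (suc k) q → q + q′ ≡ suc k * suc m →
        shift (suc k) (gauss (suc k) m) q ≡ gauss (suc k) m q′
  row {q} {q′} (below q<) eq = trans (shift-below (suc k) q<)
    (sym (gauss-large (suc k) m q′
      (linear-≤ 0 (+-mono-≤ q< (≤-reflexive (sym eq))) (row-total k m q q′))))
    where
    row-total : ∀ k m q q′ → suc (suc k * m) + (suc k + (q + q′)) + 0 ≡ q′ + (suc q + suc k * suc m)
    row-total = solve-∀
  row {q′ = q′} (above q) eq = trans (shift-above (suc k) q)
    (gauss-mirror (suc k) m
      (+-cancelˡ-≡ (suc k) _ _
        (trans (sym (+-assoc (suc k) q q′)) (trans eq (*-suc (suc k) m)))))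

-- Lower bounds for the middle coefficients

-- No part of a partition of `q` exceeds `q`, so columns added beyond `m` stay empty.
gauss-stable : ∀ k m d {q} → q ≤ m → gauss k (m + d) q ≡ gauss k m q
gauss-stable zero    m d       q≤m = refl
gauss-stable (suc k) m zero    q≤m = cong (λ n → gauss (suc k) n _) (+-identityʳ m)
gauss-stable (suc k) m (suc d) {q} q≤m = begin
  gauss (suc k) (m + suc d) q
    ≡⟨ cong (λ n → gauss (suc k) n q) (+-suc m d) ⟩
  gauss (suc k) (m + d) q + shift (suc (m + d)) (gauss k (suc (m + d))) q
    ≡⟨ cong₂ _+_ (gauss-stable (suc k) m d q≤m)
                 (shift-below (suc (m + d)) (s≤s (≤-trans q≤m (m≤m+n m d)))) ⟩
  gauss (suc k) m q + 0
    ≡⟨ +-identityʳ _ ⟩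
  gauss (suc k) m q ∎
  where open ≡-Reasoning

gauss-one : ∀ {m q} → q ≤ m → gauss 1 m q ≡ 1
gauss-one {zero}  z≤n = refl
gauss-one {suc m} {zero} _ = gauss-dual 0 m 0
gauss-one {suc m} {suc q} (s≤s q≤m) = trans (gauss-dual 0 m (suc q)) (gauss-one q≤m)

-- A partition into at most two parts is determined by the smaller one, which ranges from 0 to
-- `⌊ q /2⌋`. The recursion takes 1 from both parts.
gauss-two : ∀ {m q} → q ≤ m → gauss 2 m q ≡ suc ⌊ q /2⌋
gauss-two {zero}  z≤n = refl
gauss-two {suc m} {zero} _ =
  trans (gauss-dual 1 m 0) (cong (_+ 0) (gauss-one {suc m} z≤n))
gauss-two {suc m} {suc zero} 1≤m =
  trans (gauss-dual 1 m 1) (cong (_+ 0) (gauss-one 1≤m))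
gauss-two {suc (suc m)} {suc (suc q)} (s≤s (s≤s q≤m)) =
  trans (gauss-dual 1 (suc m) (2 + q))
    (cong₂ _+_ (gauss-one (s≤s (s≤s q≤m))) (gauss-two (m≤n⇒m≤1+n q≤m)))

-- A weak form of unimodality, enough for counting the values equal to K and
-- far easier than Sylvester's theorem.
Plateau : ℕ → ℕ → Set
Plateau k m = ∀ {s q} → s ≤ m → s ≤ q → q + s ≤ k * m → gauss k m s ≤ gauss k m q

plateau-empty : ∀ k → Plateau k 0
plateau-empty k {zero} {zero} _ _ _ = ≤-refl
plateau-empty k {zero} {suc q} _ _ le = contradiction (subst (suc (q + 0) ≤_) (*-zeroʳ k) le) λ ()

-- The mirror image `q′` satisfies the same constraints as `q`, so the comparison may be made at
-- whichever of the two is more convenient.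
mirrored : ∀ k m {s q} → s ≤ q → q + s ≤ k * m →
           (∀ q′ → q + q′ ≡ k * m → s ≤ q′ → q′ + s ≤ k * m → gauss k m s ≤ gauss k m q′) →
           gauss k m s ≤ gauss k m q
mirrored k m {s} {q} s≤q q+s≤ bound
  with m≤n⇒∃[o]m+o≡n (≤-trans (m≤m+n q s) q+s≤)
... | q′ , eq = ≤-trans
  (bound q′ eq
    (+-cancelˡ-≤ q s q′ (≤-trans q+s≤ (≤-reflexive (sym eq))))
    (≤-trans (+-monoʳ-≤ q′ s≤q) (≤-reflexive (trans (+-comm q′ q) eq))))
  (≤-reflexive (sym (gauss-mirror k m eq)))

-- Both `s` and `q` move by `d`, which is why the bound on `q + s` grows by `d + d`. For `s < d` the
-- left side is zero.
plateau-shift : ∀ {k m} d → Plateau k m →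
  ∀ {s q} → s ≤ d + m → s ≤ q → q + s ≤ k * m + (d + d) →
  shift d (gauss k m) s ≤ shift d (gauss k m) q
plateau-shift {k} {m} d plateau {s} {q} = go (position d s) (position d q)
  where
  go : ∀ {s q} → Position d s → Position d q →
       s ≤ d + m → s ≤ q → q + s ≤ k * m + (d + d) →
       shift d (gauss k m) s ≤ shift d (gauss k m) q
  go (below s<) _ _ _ _ = ≤-trans (≤-reflexive (shift-below d s<)) z≤n
  go (above s) (below q<) _ s≤q _ =
    contradiction (≤-trans (m≤m+n d s) s≤q) (<⇒≱ q<)
  go (above s) (above q) s≤ s≤q q+s≤ =
    subst₂ _≤_ (sym (shift-above d s)) (sym (shift-above d q))
      (plateau (+-cancelˡ-≤ d s m s≤) (+-cancelˡ-≤ d s q s≤q)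
        (linear-≤ 0 q+s≤ (rearrange q s d (k * m))))
    where
    rearrange : ∀ q s d x → q + s + (x + (d + d)) + 0 ≡ x + (d + q + (d + s))
    rearrange = solve-∀

-- In `gauss-dual` the shifted summand is controlled by the plateau of the narrower box, so only the
-- summand with one part fewer remains to be compared.
plateau-step : ∀ k {m} → Plateau (suc k) m →
  ∀ {s q} → s ≤ suc m → s ≤ q → q + s ≤ suc k * suc m →
  gauss k (suc m) s ≤ gauss k (suc m) q →
  gauss (suc k) (suc m) s ≤ gauss (suc k) (suc m) q
plateau-step k {m} plateau {s} {q} s≤m s≤q q+s≤ le =
  subst₂ _≤_ (sym (gauss-dual k m s)) (sym (gauss-dual k m q))
    (+-mono-≤ le (plateau-shift (suc k) plateau
      (≤-trans s≤m (s≤s (m≤n+m m k))) s≤q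
      (linear-≤ (suc k) q+s≤ (rearrange q s k m))))
  where
  rearrange : ∀ q s k m → q + s + suc k * suc m + suc k ≡ suc k * m + (suc k + suc k) + (q + s)
  rearrange = solve-∀

-- The summand left over by `plateau-step` is constantly 1 at indices up to `suc m`, and `q` or its
-- mirror image lies there.
plateau-two : ∀ m → Plateau 2 m
plateau-two zero = plateau-empty 2
plateau-two (suc m) {s} {q} s≤m s≤q q+s≤ with q ≤? suc m
... | yes q≤m = plateau-step 1 (plateau-two m) s≤m s≤q q+s≤
  (≤-reflexive (trans (gauss-one s≤m) (sym (gauss-one q≤m))))
... | no q≰m = mirrored 2 (suc m) s≤q q+s≤ λ q′ eq s≤q′ q′+s≤ →
  plateau-step 1 (plateau-two m) s≤m s≤q′ q′+s≤
    (≤-reflexive (trans (gauss-one s≤m) (sym (gauss-one {suc m} {q′}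
      (linear-≤ 1 (+-mono-≤ (≰⇒> q≰m) (≤-reflexive eq)) (rearrange q q′ m))))))
  where
  rearrange : ∀ q q′ m → q′ + (q + 2 * suc m) + 1 ≡ suc m + (suc (suc m) + (q + q′))
  rearrange = solve-∀

⌊/2⌋-subadditive : ∀ x y → ⌊ suc (x + y) /2⌋ ≤ suc (⌊ x /2⌋ + ⌊ y /2⌋)
⌊/2⌋-subadditive zero          y = ⌊n/2⌋-mono (n≤1+n (suc y))
⌊/2⌋-subadditive (suc zero)    y = ≤-refl
⌊/2⌋-subadditive (suc (suc x)) y = s≤s (⌊/2⌋-subadditive x y)

-- Counts the partitions in a 3 × (m+2) box with some part equal to 0 or m+2;
-- removing 1 from each part puts the others into a 3 × m box.
rim : ℕ → ℕ → ℕ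
rim m q = gauss 2 (suc m) q + shift (2 + m) (gauss 2 (2 + m)) q

gauss-three : ∀ m q → gauss 3 (2 + m) q ≡ rim m q + shift 3 (gauss 3 m) q
gauss-three m q = trans (cong (_+ shift (2 + m) (gauss 2 (2 + m)) q) (gauss-dual 2 m q))
  (swap (gauss 2 (suc m) q) _ _)
  where
  swap : ∀ x y z → x + y + z ≡ x + z + y
  swap = solve-∀

rim-low : ∀ m {q} → q ≤ suc m → rim m q ≡ suc ⌊ q /2⌋
rim-low m q≤ = trans (cong₂ _+_ (gauss-two q≤) (shift-below (2 + m) (s≤s q≤)))
                     (+-identityʳ _)

-- `suc ⌊ suc m /2⌋` is the largest value of the rim at indices up to `suc m`. For `e ≤ m` the two
-- summands of the rim, the first one mirrored, are `suc ⌊ m ∸ e /2⌋` and `suc ⌊ e /2⌋`, which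
-- suffice together; for larger `e` the second suffices alone.
rim-high : ∀ m e → e ≤ 2 + m → suc ⌊ suc m /2⌋ ≤ rim m (2 + m + e)
rim-high m e e≤ with e ≤? m
... | yes e≤m with m≤n⇒∃[o]m+o≡n e≤m
...   | e′ , refl = begin
  suc ⌊ suc (e + e′) /2⌋
    ≤⟨ s≤s (⌊/2⌋-subadditive e e′) ⟩
  suc (suc (⌊ e /2⌋ + ⌊ e′ /2⌋))
    ≡⟨ rearrange ⌊ e /2⌋ ⌊ e′ /2⌋ ⟩
  suc ⌊ e′ /2⌋ + suc ⌊ e /2⌋
    ≡⟨ cong₂ _+_ (gauss-two (≤-trans (m≤n+m e′ e) (n≤1+n (e + e′)))) (gauss-two e≤) ⟨
  gauss 2 (suc (e + e′)) e′ + gauss 2 (2 + (e + e′)) e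
    ≡⟨ cong₂ _+_ (gauss-mirror 2 (suc (e + e′)) (total e e′)) (sym (shift-above (2 + (e + e′)) e)) ⟩
  rim (e + e′) (2 + (e + e′) + e) ∎
  where
  open ≤-Reasoning
  rearrange : ∀ x y → suc (suc (x + y)) ≡ suc y + suc x
  rearrange = solve-∀
  total : ∀ e e′ → e′ + (2 + (e + e′) + e) ≡ 2 * suc (e + e′)
  total = solve-∀
rim-high m e e≤ | no e≰m = begin
  suc ⌊ suc m /2⌋
    ≤⟨ s≤s (⌊n/2⌋-mono (≰⇒> e≰m)) ⟩
  suc ⌊ e /2⌋
    ≡⟨ gauss-two e≤ ⟨
  gauss 2 (2 + m) e
    ≡⟨ shift-above (2 + m) e ⟨
  shift (2 + m) (gauss 2 (2 + m)) (2 + m + e)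
    ≤⟨ m≤n+m _ (gauss 2 (suc m) (2 + m + e)) ⟩
  rim m (2 + m + e) ∎
  where open ≤-Reasoning

-- At this index the bound of `rim-high` is exceeded by at most one: the first summand is mirrored
-- to index `m`, and the second is 1.
rim-corner : ∀ m → rim m (2 + m) ≤ suc (suc ⌊ suc m /2⌋)
rim-corner m = begin
  gauss 2 (suc m) (2 + m) + shift (2 + m) (gauss 2 (2 + m)) (2 + m)
    ≡⟨ cong₂ _+_ (trans (gauss-mirror 2 (suc m) (total m)) (gauss-two (n≤1+n m)))
         (trans (cong (shift (2 + m) (gauss 2 (2 + m))) (sym (+-identityʳ (2 + m))))
                (trans (shift-above (2 + m) 0) (gauss-two {2 + m} z≤n))) ⟩
  suc ⌊ m /2⌋ + 1
    ≡⟨ +-comm (suc ⌊ m /2⌋) 1 ⟩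
  suc (suc ⌊ m /2⌋)
    ≤⟨ s≤s (s≤s (⌊n/2⌋-mono (n≤1+n m))) ⟩
  suc (suc ⌊ suc m /2⌋) ∎
  where
  open ≤-Reasoning
  total : ∀ m → (2 + m) + m ≡ 2 * suc m
  total = solve-∀

-- Taking 1 from each of three parts lowers the index by 3, while the count with at most two parts
-- does not decrease. Hence an induction in steps of three from three computed cases.
gauss-three-strict : ∀ j → gauss 3 (2 + j) (1 + j) < gauss 3 (2 + j) (2 + j)
gauss-three-strict 0 = ≤-refl
gauss-three-strict 1 = ≤-refl
gauss-three-strict 2 = ≤-refl
gauss-three-strict (suc (suc (suc j))) = begin-strict
  gauss 3 (5 + j) (4 + j)
    ≡⟨ gauss-dual 2 (4 + j) (4 + j) ⟩
  gauss 2 (5 + j) (4 + j) + gauss 3 (4 + j) (1 + j)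
    ≡⟨ cong₂ _+_ (gauss-two {5 + j} (n≤1+n (4 + j))) (stable (n≤1+n (1 + j))) ⟩
  suc ⌊ 4 + j /2⌋ + gauss 3 (2 + j) (1 + j)
    <⟨ +-mono-≤-< (s≤s (⌊n/2⌋-mono (n≤1+n (4 + j)))) (gauss-three-strict j) ⟩
  suc ⌊ 5 + j /2⌋ + gauss 3 (2 + j) (2 + j)
    ≡⟨ cong₂ _+_ (gauss-two {5 + j} ≤-refl) (stable ≤-refl) ⟨
  gauss 2 (5 + j) (5 + j) + gauss 3 (4 + j) (2 + j)
    ≡⟨ gauss-dual 2 (4 + j) (5 + j) ⟨
  gauss 3 (5 + j) (5 + j) ∎
  where
  open ≤-Reasoning
  stable : ∀ {q} → q ≤ 2 + j → gauss 3 (4 + j) q ≡ gauss 3 (2 + j) q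
  stable {q} q≤ = trans (cong (λ n → gauss 3 n q) (+-comm 2 (2 + j))) (gauss-stable 3 (2 + j) 2 q≤)

-- The worst case s = m + 2, where the rim alone may fall short by one.
plateau-three-corner : ∀ m → Plateau 3 m → ∀ e → e ≤ m →
                       gauss 3 (2 + m) (2 + m) ≤ gauss 3 (2 + m) (3 + m + e)
plateau-three-corner 0 _ zero _ = s≤s (s≤s z≤n)
plateau-three-corner 1 _ zero _ = ≤-refl
plateau-three-corner 1 _ (suc zero) _ = ≤-refl
plateau-three-corner 1 _ (suc (suc e)) (s≤s ())
plateau-three-corner (suc (suc j)) plateau e e≤m = begin
  gauss 3 (2 + m) (2 + m)
    ≡⟨ gauss-three m (2 + m) ⟩
  rim m (2 + m) + gauss 3 m (1 + j)
    ≤⟨ +-monoˡ-≤ (gauss 3 m (1 + j)) (rim-corner m) ⟩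
  suc (suc ⌊ suc m /2⌋) + gauss 3 m (1 + j)
    -- The unit that the rim may lack is charged to the inner box, whose coefficient grows strictly
    -- from index `1 + j` to `2 + j`.
    ≡⟨ +-suc (suc ⌊ suc m /2⌋) _ ⟨
  suc ⌊ suc m /2⌋ + suc (gauss 3 m (1 + j))
    ≤⟨ +-mono-≤ (rim-high m (suc e) (s≤s (m≤n⇒m≤1+n e≤m)))
         (≤-trans (gauss-three-strict j) (plateau ≤-refl (m≤m+n m e)
           (linear-≤ 0 e≤m (rearrange m e)))) ⟩
  rim m (2 + m + suc e) + gauss 3 m (m + e)
    ≡⟨ cong (λ q → rim m q + gauss 3 m (m + e)) (+-suc (2 + m) e) ⟩
  rim m (3 + m + e) + gauss 3 m (m + e)
    ≡⟨ gauss-three m (3 + m + e) ⟨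
  gauss 3 (2 + m) (3 + m + e) ∎
  where
  open ≤-Reasoning
  m = 2 + j
  rearrange : ∀ m e → m + e + m + m + 0 ≡ 3 * m + e
  rearrange = solve-∀

plateau-three-low : ∀ m → Plateau 3 m → ∀ {s q} → s ≤ 2 + m → s ≤ q → q + s ≤ 3 * (2 + m) →
                    q ≤ (2 + m) + (2 + m) → gauss 3 (2 + m) s ≤ gauss 3 (2 + m) q
plateau-three-low m plateau {s} {q} s≤ s≤q q+s≤ q≤ with m≤n⇒m<n∨m≡n s≤
... | inj₁ (s≤s s≤m) = subst₂ _≤_ (sym (gauss-three m s)) (sym (gauss-three m q))
  (+-mono-≤ (≤-trans (≤-reflexive (rim-low m s≤m)) (rim-≥ (position (2 + m) q) s≤q q≤))
    (plateau-shift 3 plateau (≤-trans s≤ (n≤1+n (2 + m))) s≤q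
      (≤-trans q+s≤ (≤-reflexive (total m)))))
  where
  total : ∀ m → 3 * (2 + m) ≡ 3 * m + 6
  total = solve-∀
  rim-≥ : ∀ {q} → Position (2 + m) q → s ≤ q → q ≤ (2 + m) + (2 + m) → suc ⌊ s /2⌋ ≤ rim m q
  rim-≥ (below (s≤s q≤m)) s≤q _ =
    ≤-trans (s≤s (⌊n/2⌋-mono s≤q)) (≤-reflexive (sym (rim-low m q≤m)))
  rim-≥ (above e) _ q≤ = ≤-trans (s≤s (⌊n/2⌋-mono s≤m))
    (rim-high m e (+-cancelˡ-≤ (2 + m) e (2 + m) q≤))
... | inj₂ refl with m≤n⇒∃[o]m+o≡n s≤q
...   | zero  , refl = ≤-reflexive (cong (gauss 3 (2 + m)) (sym (+-identityʳ (2 + m))))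
...   | suc e , refl with e ≤? m
...     | yes e≤m = ≤-trans (plateau-three-corner m plateau e e≤m)
  (≤-reflexive (cong (gauss 3 (2 + m)) (sym (+-suc (2 + m) e))))
-- Only `q = 2 * (2 + m)` remains, the mirror image of `s = 2 + m`.
...     | no e≰m = ≤-reflexive (gauss-mirror 3 (2 + m)
  (trans (cong (λ e → 2 + m + (2 + m + suc e)) e≡) (total m)))
  where
  total : ∀ m → 2 + m + (2 + m + suc (suc m)) ≡ 3 * (2 + m)
  total = solve-∀
  e≡ : e ≡ suc m
  e≡ = ≤-antisym (s≤s⁻¹ (+-cancelˡ-≤ (2 + m) (suc e) (2 + m) q≤)) (≰⇒> e≰m)

-- With three parts `plateau-step` may require a comparison for two parts outside the range of
-- `plateau-two`. Removing the rim leads from `2 + m` to `m` instead, hence the base cases 0 and 1.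
plateau-three : ∀ m → Plateau 3 m
plateau-three 0 = plateau-empty 3
plateau-three 1 {s} {0} _ z≤n _ = ≤-refl
plateau-three 1 {0} {1} _ _ _ = ≤-refl
plateau-three 1 {1} {1} _ _ _ = ≤-refl
plateau-three 1 {0} {2} _ _ _ = ≤-refl
plateau-three 1 {1} {2} _ _ _ = ≤-refl
plateau-three 1 {0} {3} _ _ _ = ≤-refl
plateau-three 1 {1} {3} _ _ (s≤s (s≤s (s≤s ())))
plateau-three 1 {suc (suc _)} {_} (s≤s ()) _ _
plateau-three 1 {_} {suc (suc (suc (suc _)))} _ _ (s≤s (s≤s (s≤s ())))
plateau-three (suc (suc m)) {s} {q} s≤ s≤q q+s≤ with q ≤? (2 + m) + (2 + m)
... | yes q≤ = plateau-three-low m (plateau-three m) s≤ s≤q q+s≤ q≤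
... | no q≰ = mirrored 3 (2 + m) s≤q q+s≤ λ q′ eq s≤q′ q′+s≤ →
  plateau-three-low m (plateau-three m) s≤ s≤q′ q′+s≤
    (linear-≤ (3 + m) (+-mono-≤ (≰⇒> q≰) (≤-reflexive eq)) (rearrange q q′ m))
  where
  rearrange : ∀ q q′ m → q′ + (q + 3 * (2 + m)) + (3 + m) ≡
                         (2 + m) + (2 + m) + (suc ((2 + m) + (2 + m)) + (q + q′))
  rearrange = solve-∀

-- The box with one part fewer settles the case `q + s ≤ (3 + i) * suc m`. Otherwise the mirror
-- image satisfies `q′ + s < suc m + 2 * s ≤ 3 * suc m`, which is again in that range. This argument
-- starts at four parts, so three parts are treated separately.
plateau-large : ∀ i m → Plateau (3 + i) m
plateau-large zero    m = plateau-three m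
plateau-large (suc i) zero = plateau-empty (4 + i)
plateau-large (suc i) (suc m) {s} {q} s≤m s≤q q+s≤ with q + s ≤? (3 + i) * suc m
... | yes le = plateau-step (3 + i) (plateau-large (suc i) m) s≤m s≤q q+s≤
  (plateau-large i (suc m) s≤m s≤q le)
... | no ≰ = mirrored (4 + i) (suc m) s≤q q+s≤ λ q′ eq s≤q′ q′+s≤ →
  plateau-step (3 + i) (plateau-large (suc i) m) s≤m s≤q′ q′+s≤
    (plateau-large i (suc m) s≤m s≤q′
      (linear-≤ (1 + i * suc m) (+-mono-≤ (+-mono-≤ (≰⇒> ≰) (≤-reflexive eq)) (+-mono-≤ s≤m s≤m))
        (rearrange q q′ s i m)))
  where
  rearrange : ∀ q q′ s i m →
    q′ + s + (q + s + (4 + i) * suc m + (suc m + suc m)) + (1 + i * suc m) ≡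
    (3 + i) * suc m + (suc ((3 + i) * suc m) + (q + q′) + (s + s))
  rearrange = solve-∀

plateau : ∀ {k} m → 2 ≤ k → Plateau k m
plateau {suc (suc zero)}    m _ = plateau-two m
plateau {suc (suc (suc i))} m _ = plateau-large i m
plateau {suc zero} m (s≤s ())

-- Partitions in a box

length-unique : ∀ {A : Set} {xs ys : List A} → Unique xs → Unique ys →
                (∀ {x} → x ∈ xs ⇔ x ∈ ys) → length xs ≡ length ys
length-unique xs! ys! xs⇔ys = ↭-length (∼bag⇒↭ (unique∧set⇒bag xs! ys! xs⇔ys))

mutual
  -- Follows the recursion of `gauss`, so that the lengths agree term by term: first the partitions
  -- without a part `suc m`, then those with largest part `suc m`.
  boxed : ℕ → ℕ → ℕ → List (List ℕ)
  boxed zero    m       zero    = [] ∷ []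
  boxed zero    m       (suc q) = []
  boxed (suc k) zero    zero    = [] ∷ []
  boxed (suc k) zero    (suc q) = []
  boxed (suc k) (suc m) q       = boxed (suc k) m q ++ topped k m (position (suc m) q)

  topped : ∀ k m {q} → Position (suc m) q → List (List ℕ)
  topped k m (below _) = []
  topped k m (above q) = map (suc m ∷_) (boxed k (suc m) q)

length-boxed : ∀ k m q → length (boxed k m q) ≡ gauss k m q
length-boxed zero    m       zero    = refl
length-boxed zero    m       (suc q) = refl
length-boxed (suc k) zero    zero    = refl
length-boxed (suc k) zero    (suc q) = refl
length-boxed (suc k) (suc m) q = trans (List.length-++ (boxed (suc k) m q))
  (cong₂ _+_ (length-boxed (suc k) m q) (length-topped (position (suc m) q)))
  where
  length-topped : ∀ {q} (i : Position (suc m) q) →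
                  length (topped k m i) ≡ shift (suc m) (gauss k (suc m)) q
  length-topped (below q<) = sym (shift-below (suc m) q<)
  length-topped (above q)  = trans (List.length-map (suc m ∷_) (boxed k (suc m) q))
    (trans (length-boxed k (suc m) q) (sym (shift-above (suc m) q)))

Boxed : ℕ → ℕ → ℕ → List ℕ → Set
Boxed k m q ps = IsPartition q ps × length ps ≤ k × All (_≤ m) ps

cons-linked : ∀ {x ps} → All (_≤ x) ps → Linked _≥_ ps → Linked _≥_ (x ∷ ps)
cons-linked []       []        = [-]
cons-linked (y≤ ∷ _) [-]       = y≤ ∷ [-]
cons-linked (y≤ ∷ _) (z≤ ∷ zs) = y≤ ∷ z≤ ∷ zs

mutual
  boxed-sound : ∀ k m q {ps} → ps ∈ boxed k m q → Boxed k m q ps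
  boxed-sound zero    m       zero    (here refl) = ([] , [] , refl) , z≤n , []
  boxed-sound (suc k) zero    zero    (here refl) = ([] , [] , refl) , z≤n , []
  boxed-sound (suc k) (suc m) q ps∈ with ∈-++⁻ (boxed (suc k) m q) ps∈
  ... | inj₁ ps∈ˡ with boxed-sound (suc k) m q ps∈ˡ
  ...   | isP , len , ps≤ = isP , len , All.map m≤n⇒m≤1+n ps≤
  boxed-sound (suc k) (suc m) q ps∈ | inj₂ ps∈ʳ = topped-sound k m (position (suc m) q) ps∈ʳ

  topped-sound : ∀ k m {q} (i : Position (suc m) q) {ps} →
                 ps ∈ topped k m i → Boxed (suc k) (suc m) q ps
  topped-sound k m (above q) ps∈ with ∈-map⁻ (suc m ∷_) ps∈
  ... | ps , ps∈′ , refl with boxed-sound k (suc m) q ps∈′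
  ...   | (pos , dec , eq) , len , ps≤ =
    (s≤s z≤n ∷ pos , cons-linked ps≤ dec , cong (suc m +_) eq) , s≤s len , ≤-refl ∷ ps≤

tail-bounded : ∀ {x ps} → Linked _≥_ (x ∷ ps) → All (_≤ x) (x ∷ ps)
tail-bounded = Linked⇒All (flip ≤-trans) ≤-refl

mutual
  boxed-complete : ∀ k m q {ps} → Boxed k m q ps → ps ∈ boxed k m q
  boxed-complete zero m q {[]} ((_ , _ , refl) , _ , _) = here refl
  boxed-complete (suc k) zero q {[]} ((_ , _ , refl) , _ , _) = here refl
  boxed-complete (suc k) zero q {_ ∷ _} ((0<x ∷ _ , _) , _ , x≤0 ∷ _) =
    contradiction x≤0 (<⇒≱ 0<x)
  boxed-complete (suc k) (suc m) q {[]} (isP , len , _) =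
    ∈-++⁺ˡ (boxed-complete (suc k) m q (isP , len , []))
  boxed-complete (suc k) (suc m) q {x ∷ ps} (isP@(pos , dec , eq) , len , x≤ ∷ ps≤)
    with m≤n⇒m<n∨m≡n x≤
  ... | inj₁ (s≤s x≤m) = ∈-++⁺ˡ (boxed-complete (suc k) m q
    (isP , len , All.map (λ y≤x → ≤-trans y≤x x≤m) (tail-bounded dec)))
  ... | inj₂ refl = ∈-++⁺ʳ (boxed (suc k) m q)
    (topped-complete k m (position (suc m) q) eq
      ((All.tail pos , Linked.tail dec , refl) , s≤s⁻¹ len , ps≤))

  topped-complete : ∀ k m {q} (i : Position (suc m) q) {ps} → suc m + sum ps ≡ q →
                    Boxed k (suc m) (sum ps) ps → (suc m ∷ ps) ∈ topped k m i
  topped-complete k m (below q<) {ps} refl _ = contradiction q< (≤⇒≯ (m≤m+n (suc m) (sum ps)))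
  topped-complete k m (above q) {ps} eq isBoxed with +-cancelˡ-≡ (suc m) (sum ps) q eq
  ... | refl = ∈-map⁺ (suc m ∷_) (boxed-complete k (suc m) (sum ps) isBoxed)

boxed-unique : ∀ k m q → Unique (boxed k m q)
boxed-unique zero    m       zero    = [] ∷ []
boxed-unique zero    m       (suc q) = []
boxed-unique (suc k) zero    zero    = [] ∷ []
boxed-unique (suc k) zero    (suc q) = []
boxed-unique (suc k) (suc m) q =
  Unique.++⁺ (boxed-unique (suc k) m q) (topped-unique (position (suc m) q)) λ (l , r) →
    separate (position (suc m) q) l r
  where
  topped-unique : ∀ {q} (i : Position (suc m) q) → Unique (topped k m i)
  topped-unique (below _) = []
  topped-unique (above q) = Unique.map⁺ List.∷-injectiveʳ (boxed-unique k (suc m) q)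

  separate : ∀ {q′} (i : Position (suc m) q′) {ps} →
             ps ∈ boxed (suc k) m q → ¬ (ps ∈ topped k m i)
  separate (above q′) ps∈ ps∈′ with ∈-map⁻ (suc m ∷_) ps∈′
  ... | _ , _ , refl with boxed-sound (suc k) m q ps∈
  ...   | _ , _ , 1+m≤m ∷ _ = 1+n≰n 1+m≤m

-- Monotonicity and growth of the partition functions

parts≤sum : ∀ ps → All (_≤ sum ps) ps
parts≤sum []       = []
parts≤sum (x ∷ ps) = m≤m+n x (sum ps) ∷
  All.map (λ y≤ → ≤-trans y≤ (m≤n+m (sum ps) x)) (parts≤sum ps)

length≤sum : ∀ {ps} → All (0 <_) ps → length ps ≤ sum ps
length≤sum []          = z≤n
length≤sum (0<x ∷ pos) = +-mono-≤ 0<x (length≤sum pos)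

-- Every part of a partition of `ξ` is at most `ξ`, so a box of width `m ≥ ξ` restricts only the
-- number of parts.
p≤-gauss : ∀ r {m ξ} → ξ ≤ m → p≤ r ξ ≡ gauss r m ξ
p≤-gauss r {m} {ξ} ξ≤m = trans
  (length-unique (Unique.filter⁺ short? (partitions-unique ξ)) (boxed-unique r m ξ)
    (mk⇔ to from))
  (length-boxed r m ξ)
  where
  short? = λ (ps : List ℕ) → length ps ≤? r
  to : ∀ {ps} → ps ∈ filter short? (partitions ξ) → ps ∈ boxed r m ξ
  to {ps} ps∈ with ∈-filter⁻ short? {xs = partitions ξ} ps∈
  ... | ps∈′ , len with Equivalence.to (∈-partitions {ξ}) ps∈′
  ...   | isP@(_ , _ , refl) = boxed-complete r m ξ
    (isP , len , All.map (λ y≤ → ≤-trans y≤ ξ≤m) (parts≤sum ps))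
  from : ∀ {ps} → ps ∈ boxed r m ξ → ps ∈ filter short? (partitions ξ)
  from ps∈ with boxed-sound r m ξ ps∈
  ... | isP , len , _ = ∈-filter⁺ short? (Equivalence.from ∈-partitions isP) len

p≤-all : ∀ {r ξ} → ξ ≤ r → p≤ r ξ ≡ p ξ
p≤-all {r} {ξ} ξ≤r = cong length (List.filter-all (λ ps → length ps ≤? r)
  (All.tabulate λ ps∈ → short (Equivalence.to ∈-partitions ps∈)))
  where
  short : ∀ {ps} → IsPartition ξ ps → length ps ≤ r
  short (pos , _ , refl) = ≤-trans (length≤sum pos) ξ≤r

-- An instance of `plateau` in the box of width `q`, where `q + s ≤ 2 * q ≤ r * q`.
p≤-mono : ∀ {r s q} → 2 ≤ r → s ≤ q → p≤ r s ≤ p≤ r q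
p≤-mono {r} {s} {q} 2≤r s≤q =
  subst₂ _≤_ (sym (p≤-gauss r s≤q)) (sym (p≤-gauss r ≤-refl))
    (plateau q 2≤r s≤q s≤q (≤-trans (+-monoʳ-≤ q (≤-trans s≤q (m≤m+n q 0))) (*-monoˡ-≤ q 2≤r)))

-- Either there are at most `r` parts, or exactly `suc r`, and 1 is taken from each.
p≤-rec : ∀ r q → p≤ (suc r) (suc r + q) ≡ p≤ r (suc r + q) + p≤ (suc r) q
p≤-rec r q = begin
  p≤ (suc r) (suc r + q)
    ≡⟨ p≤-gauss (suc r) {suc r + q} ≤-refl ⟩
  gauss (suc r) (suc r + q) (suc r + q)
    ≡⟨ gauss-dual r (r + q) (suc r + q) ⟩
  gauss r (suc r + q) (suc r + q) + shift (suc r) (gauss (suc r) (r + q)) (suc r + q)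
    ≡⟨ cong₂ _+_ (sym (p≤-gauss r ≤-refl))
         (trans (shift-above (suc r) q) (sym (p≤-gauss (suc r) (m≤n+m q r)))) ⟩
  p≤ r (suc r + q) + p≤ (suc r) q ∎
  where open ≡-Reasoning

p≤-zero : ∀ r → p≤ r 0 ≡ 1
p≤-zero zero    = refl
p≤-zero (suc r) = refl

-- The partitions into at most `2 + ξ` parts do not become fewer, and the partition of `3 + ξ` into
-- ones is new.
p-step : ∀ ξ → p (2 + ξ) < p (3 + ξ)
p-step ξ = begin
  suc (p (2 + ξ))
    ≡⟨ cong suc (p≤-all {2 + ξ} ≤-refl) ⟨
  suc (p≤ (2 + ξ) (2 + ξ))
    ≤⟨ s≤s (p≤-mono (s≤s (s≤s z≤n)) (n≤1+n (2 + ξ))) ⟩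
  suc (p≤ (2 + ξ) (3 + ξ))
    ≡⟨ +-comm 1 _ ⟩
  p≤ (2 + ξ) (3 + ξ) + 1
    ≡⟨ cong (λ z → p≤ (2 + ξ) z + 1) (+-identityʳ (3 + ξ)) ⟨
  p≤ (2 + ξ) (3 + ξ + 0) + p≤ (3 + ξ) 0
    ≡⟨ p≤-rec (2 + ξ) 0 ⟨
  p≤ (3 + ξ) (3 + ξ + 0)
    ≡⟨ p≤-all (≤-reflexive (+-identityʳ (3 + ξ))) ⟩
  p (3 + ξ + 0)
    ≡⟨ cong p (+-identityʳ (3 + ξ)) ⟩
  p (3 + ξ) ∎
  where open ≤-Reasoning

-- The only repetition is `p 0 ≡ p 1`, where the value is 1; it is excluded by `2 ≤ p j`.
p-strict : ∀ {i j} → 2 ≤ p j → i < j → p i < p j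
p-strict {i} {suc j} 2≤p i<j with m≤n⇒m<n∨m≡n (s≤s⁻¹ i<j)
p-strict {i} {suc (suc (suc j))} 2≤p i<j | inj₁ i<j′ =
  <-trans (p-strict (p-lower (2 + j) 1 (s≤s (s≤s z≤n))) i<j′) (p-step j)
p-strict {zero} {suc (suc zero)} _ _ | inj₁ _ = ≤-refl
p-strict {suc i} {suc (suc zero)} _ _ | inj₁ (s≤s ())
p-strict {zero}        {suc zero}          (s≤s ()) i<j | inj₂ refl
p-strict {suc zero}    {suc (suc zero)}    2≤p i<j | inj₂ refl = ≤-refl
p-strict {suc (suc j)} {suc (suc (suc j))} 2≤p i<j | inj₂ refl = p-step j

p-injective : ∀ {i j} → 2 ≤ p i → p i ≡ p j → i ≡ j
p-injective {i} {j} 2≤p eq with <-cmp i j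
... | tri< i<j _ _ = contradiction eq (<⇒≢ (p-strict (subst (2 ≤_) eq 2≤p) i<j))
... | tri≈ _ i≡j _ = i≡j
... | tri> _ _ j<i = contradiction (sym eq) (<⇒≢ (p-strict 2≤p j<i))

-- Two parts give `suc ⌊ m /2⌋`, and each further part allowed adds at least one partition.
p≤-growth : ∀ i {m} → 2 + i ≤ m → suc ⌊ m /2⌋ + i ≤ p≤ (2 + i) m
p≤-growth zero {m} _ = ≤-reflexive (trans (+-identityʳ _)
  (sym (trans (p≤-gauss 2 {m} ≤-refl) (gauss-two {m} ≤-refl))))
p≤-growth (suc i) 3+i≤m with m≤n⇒∃[o]m+o≡n 3+i≤m
... | q , refl = begin
  suc ⌊ m /2⌋ + suc i
    ≡⟨ rearrange ⌊ m /2⌋ i ⟩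
  suc ⌊ m /2⌋ + i + 1
    ≤⟨ +-mono-≤ (p≤-growth i (≤-trans (n≤1+n (2 + i)) 3+i≤m))
         (≤-trans (≤-reflexive (sym (p≤-zero (3 + i)))) (p≤-mono {s = 0} {q} (s≤s (s≤s z≤n)) z≤n)) ⟩
  p≤ (2 + i) m + p≤ (3 + i) q
    ≡⟨ p≤-rec (2 + i) q ⟨
  p≤ (3 + i) m ∎
  where
  open ≤-Reasoning
  m = 3 + i + q
  rearrange : ∀ x i → suc x + suc i ≡ suc x + i + 1
  rearrange = solve-∀

⌊/2⌋-+ : ∀ i m → ⌊ i + m /2⌋ ≤ ⌊ m /2⌋ + i
⌊/2⌋-+ zero    m = ≤-reflexive (sym (+-identityʳ _))
⌊/2⌋-+ (suc i) m = ≤-trans (⌊n/2⌋-mono (n≤1+n (suc (i + m))))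
  (≤-trans (s≤s (⌊/2⌋-+ i m)) (≤-reflexive (sym (+-suc ⌊ m /2⌋ i))))

-- The bound of `p≤-growth` exceeds half of `r + m ∸ 2`. The hypothesis is on `r + m` because this
-- is the length of the words.
p≤-big : ∀ {K r m} → 2 ≤ r → r ≤ m → 2 + (K + K) ≤ r + m → K < p≤ r m
p≤-big {K} {suc (suc i)} {m} _ r≤m (s≤s (s≤s 2K≤)) = begin-strict
  K                   ≡⟨ n≡⌊n+n/2⌋ K ⟩
  ⌊ K + K /2⌋         ≤⟨ ⌊n/2⌋-mono 2K≤ ⟩
  ⌊ i + m /2⌋         ≤⟨ ⌊/2⌋-+ i m ⟩
  ⌊ m /2⌋ + i         <⟨ ≤-refl ⟩
  suc ⌊ m /2⌋ + i     ≤⟨ p≤-growth i r≤m ⟩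
  p≤ (2 + i) m        ∎
  where open ≤-Reasoning
p≤-big {r = suc zero} (s≤s ())

-- Words with given numbers of a, b and ab

length-filter-map : ∀ {A B : Set} {P : B → Set} (P? : Unary.Decidable P) (f : A → B) xs →
                    length (filter P? (map f xs)) ≡ length (filter (P? ∘ f) xs)
length-filter-map P? f []       = refl
length-filter-map P? f (x ∷ xs) with does (P? (f x))
... | true  = cong suc (length-filter-map P? f xs)
... | false = length-filter-map P? f xs

length-filter-none : ∀ {A : Set} {P : A → Set} (P? : Unary.Decidable P) →
                     (∀ x → ¬ P x) → ∀ xs → length (filter P? xs) ≡ 0
length-filter-none P? ¬P xs = cong length (List.filter-none P? (All.universal ¬P xs))

length-filter-⇔ : ∀ {A : Set} {P Q : A → Set} (P? : Unary.Decidable P) (Q? : Unary.Decidable Q) →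
                  (∀ x → P x → Q x) → (∀ x → Q x → P x) →
                  ∀ xs → length (filter P? xs) ≡ length (filter Q? xs)
length-filter-⇔ P? Q? P⊆Q Q⊆P xs =
  cong length (List.filter-≐ P? Q? ((λ {x} → P⊆Q x) , (λ {x} → Q⊆P x)) xs)

length-filter-++ : ∀ {A : Set} {P : A → Set} (P? : Unary.Decidable P) xs ys →
  length (filter P? (xs ++ ys)) ≡ length (filter P? xs) + length (filter P? ys)
length-filter-++ P? xs ys =
  trans (cong length (List.filter-++ P? xs ys)) (List.length-++ (filter P? xs))

infix 4 _≟ˢ_
_≟ˢ_ = List.≡-dec _≟ᴸ_

binom-∷ : ∀ {n} x (w : Word n) u →
  binom (x ∷ w) u ≡ length (filter (λ v → x ∷ v ≟ˢ u) (subwords w)) + binom w u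
binom-∷ x w u = trans (length-filter-++ (_≟ˢ u) (map (x ∷_) (subwords w)) (subwords w))
  (cong (_+ binom w u) (length-filter-map (_≟ˢ u) (x ∷_) (subwords w)))

binom-[] : ∀ {n} (w : Word n) → binom w [] ≡ 1
binom-[] []      = refl
binom-[] (x ∷ w) = trans (binom-∷ x w [])
  (cong₂ _+_ (length-filter-none (λ v → x ∷ v ≟ˢ []) (λ _ ()) (subwords w)) (binom-[] w))

binom-∷-≡ : ∀ {n} x (w : Word n) u → binom (x ∷ w) (x ∷ u) ≡ binom w u + binom w (x ∷ u)
binom-∷-≡ x w u = trans (binom-∷ x w (x ∷ u)) (cong (_+ binom w (x ∷ u))
  (length-filter-⇔ (λ v → x ∷ v ≟ˢ x ∷ u) (_≟ˢ u)
    (λ _ → List.∷-injectiveʳ) (λ _ → cong (x ∷_)) (subwords w)))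

binom-∷-≢ : ∀ {n x y} (w : Word n) u → x ≢ y → binom (x ∷ w) (y ∷ u) ≡ binom w (y ∷ u)
binom-∷-≢ {x = x} {y} w u x≢y = trans (binom-∷ x w (y ∷ u)) (cong (_+ binom w (y ∷ u))
  (length-filter-none (λ v → x ∷ v ≟ˢ y ∷ u) (λ _ → x≢y ∘ List.∷-injectiveˡ) (subwords w)))

#b #ab : ∀ {n} → Word n → ℕ
#b  w = binom w (b ∷ [])
#ab w = binom w (a ∷ b ∷ [])

#a+#b : ∀ {n} (w : Word n) → #a w + #b w ≡ n
#a+#b []      = refl
#a+#b (a ∷ w) = cong suc (trans (cong (#a w +_) (binom-∷-≢ w [] λ ())) (#a+#b w))
#a+#b (b ∷ w) = begin
  #a w + #b (b ∷ w)         ≡⟨ cong (#a w +_) (binom-∷-≡ b w []) ⟩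
  #a w + (binom w [] + #b w) ≡⟨ cong (λ t → #a w + (t + #b w)) (binom-[] w) ⟩
  #a w + suc (#b w)         ≡⟨ +-suc (#a w) (#b w) ⟩
  suc (#a w + #b w)         ≡⟨ cong suc (#a+#b w) ⟩
  _                         ∎
  where open ≡-Reasoning

wordCount : ℕ → ℕ → ℕ → ℕ
wordCount n k q = length (filter (λ (w : Word n) → (#a w ≟ k) ×-dec (#ab w ≟ q)) (words n))

-- Split by the first letter: a leading `a` forms one `ab` with each later `b`, a leading `b` forms
-- none.
wordCount-suc : ∀ n k q → wordCount (suc n) k q ≡
  length (filter (λ w → (suc (#a w) ≟ k) ×-dec (#b w + #ab w ≟ q)) (words n)) + wordCount n k q
wordCount-suc n k q = trans (length-filter-++ P? (map (a ∷_) (words n)) (map (b ∷_) (words n)))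
  (cong₂ _+_
    (trans (length-filter-map P? (a ∷_) (words n))
      (length-filter-⇔ (P? ∘ (a ∷_)) (λ w → (suc (#a w) ≟ k) ×-dec (#b w + #ab w ≟ q))
        (λ w (eq , eq′) → eq , trans (sym (binom-∷-≡ a w (b ∷ []))) eq′)
        (λ w (eq , eq′) → eq , trans (binom-∷-≡ a w (b ∷ [])) eq′) (words n)))
    (trans (length-filter-map P? (b ∷_) (words n))
      (length-filter-⇔ (P? ∘ (b ∷_)) (λ w → (#a w ≟ k) ×-dec (#ab w ≟ q))
        (λ w (eq , eq′) → eq , trans (sym (binom-∷-≢ w (b ∷ []) λ ())) eq′)
        (λ w (eq , eq′) → eq , trans (binom-∷-≢ w (b ∷ []) λ ()) eq′) (words n))))
  where P? = λ (w : Word (suc n)) → (#a w ≟ k) ×-dec (#ab w ≟ q)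

wordCount-large : ∀ {n k} q → n < k → wordCount n k q ≡ 0
wordCount-large {n} {k} q n<k = length-filter-none (λ w → (#a w ≟ k) ×-dec (#ab w ≟ q))
  (λ w (eq , _) → <⇒≱ n<k
    (≤-trans (≤-reflexive (sym eq)) (≤-trans (m≤m+n (#a w) (#b w)) (≤-reflexive (#a+#b w)))))
  (words n)

-- The rest of the word has exactly `m` letters `b`, so the leading `a` shifts the count by `m`.
wordCount-a : ∀ {n} k m q → k + m ≡ n →
  length (filter (λ w → (suc (#a w) ≟ suc k) ×-dec (#b w + #ab w ≟ q)) (words n)) ≡
  shift m (wordCount n k) q
wordCount-a {n} k m q k+m≡n = go (position m q)
  where
  #b≡m : ∀ (w : Word n) → suc (#a w) ≡ suc k → #b w ≡ m
  #b≡m w eq = +-cancelˡ-≡ k (#b w) m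
    (trans (cong (_+ #b w) (sym (suc-injective eq))) (trans (#a+#b w) (sym k+m≡n)))

  go : ∀ {q} → Position m q →
    length (filter (λ w → (suc (#a w) ≟ suc k) ×-dec (#b w + #ab w ≟ q)) (words n)) ≡
    shift m (wordCount n k) q
  go {q} (below q<m) = trans
    (length-filter-none (λ w → (suc (#a w) ≟ suc k) ×-dec (#b w + #ab w ≟ q))
      (λ w (eq , eq′) → <⇒≱ q<m (≤-trans (≤-reflexive (sym (#b≡m w eq)))
        (≤-trans (m≤m+n (#b w) (#ab w)) (≤-reflexive eq′)))) (words n))
    (sym (shift-below m q<m))
  go (above q) = trans
    (length-filter-⇔ (λ w → (suc (#a w) ≟ suc k) ×-dec (#b w + #ab w ≟ m + q))
      (λ w → (#a w ≟ k) ×-dec (#ab w ≟ q))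
      (λ w (eq , eq′) → suc-injective eq ,
        +-cancelˡ-≡ m (#ab w) q (trans (cong (_+ #ab w) (sym (#b≡m w eq))) eq′))
      (λ w (eq , eq′) → cong suc eq , cong₂ _+_ (#b≡m w (cong suc eq)) eq′) (words n))
    (sym (shift-above m q))

-- Each `a` corresponds to a part, the number of letters `b` to its right. A leading `a` is a part
-- of full size `m`, so the split by the first letter is the defining recursion of `gauss`.
wordCount-gauss : ∀ {n} k m → k + m ≡ n → ∀ q → wordCount n k q ≡ gauss k m q
wordCount-gauss {zero} zero zero refl zero    = refl
wordCount-gauss {zero} zero zero refl (suc q) = refl
wordCount-gauss {suc n} zero (suc m) refl q = trans (wordCount-suc n 0 q)
  (cong₂ _+_ (length-filter-none (λ w → (suc (#a w) ≟ 0) ×-dec (#b w + #ab w ≟ q))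
                                 (λ _ ()) (words n))
             (wordCount-gauss zero m refl q))
wordCount-gauss {suc n} (suc k) zero eq q = begin
  wordCount (suc n) (suc k) q
    ≡⟨ wordCount-suc n (suc k) q ⟩
  _ + wordCount n (suc k) q
    ≡⟨ cong₂ _+_ (wordCount-a k 0 q (suc-injective eq))
         (wordCount-large q (≤-reflexive (trans (sym eq) (+-identityʳ (suc k))))) ⟩
  wordCount n k q + 0
    ≡⟨ +-identityʳ _ ⟩
  wordCount n k q
    ≡⟨ wordCount-gauss k 0 (suc-injective eq) q ⟩
  gauss k 0 q
    ≡⟨ gauss-comm k 0 q ⟩
  δ₀ q ∎
  where open ≡-Reasoning
wordCount-gauss {suc n} (suc k) (suc m) eq q = begin
  wordCount (suc n) (suc k) q
    ≡⟨ wordCount-suc n (suc k) q ⟩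
  _ + wordCount n (suc k) q
    ≡⟨ cong₂ _+_
         (trans (wordCount-a k (suc m) q (suc-injective eq))
                (shift-cong (suc m) (wordCount-gauss k (suc m) (suc-injective eq)) q))
         (wordCount-gauss (suc k) m (trans (sym (+-suc k m)) (suc-injective eq)) q) ⟩
  shift (suc m) (gauss k (suc m)) q + gauss (suc k) m q
    ≡⟨ +-comm _ (gauss (suc k) m q) ⟩
  gauss (suc k) (suc m) q ∎
  where open ≡-Reasoning

-- Equivalence classes and their representatives

classSize-gauss : ∀ {n k m} (w : Word n) → #a w ≡ k → k + m ≡ n →
                  classSize w ≡ gauss k m (#ab w)
classSize-gauss {n} {k} {m} w refl eq = trans
  (length-filter-⇔ (w ∼₂?_) (λ u → (#a u ≟ k) ×-dec (#ab u ≟ #ab w))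
    (λ _ (x , y) → sym x , sym y) (λ _ (x , y) → sym x , sym y) (words n))
  (wordCount-gauss k m eq (#ab w))

word-exists : ∀ {n k m q} → k + m ≡ n → 0 < gauss k m q →
              ∃[ w ] w ∈ words n × #a w ≡ k × #ab w ≡ q
word-exists {n} {k} {m} {q} eq pos = go (filter P? (words n)) (λ w∈ → ∈-filter⁻ P? {xs = words n} w∈)
  (subst (0 <_) (sym (wordCount-gauss k m eq q)) pos)
  where
  P? = λ (w : Word n) → (#a w ≟ k) ×-dec (#ab w ≟ q)
  go : ∀ ws → (∀ {w} → w ∈ ws → w ∈ words n × #a w ≡ k × #ab w ≡ q) →
       0 < length ws → ∃[ w ] w ∈ words n × #a w ≡ k × #ab w ≡ q
  go (w ∷ _) sound _ = w , sound (here refl)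

∼₂-decSetoid : ℕ → DecSetoid _ _
∼₂-decSetoid n = record
  { Carrier = Word n
  ; _≈_ = _∼₂_
  ; isDecEquivalence = record
    { isEquivalence = record
      { refl  = refl , refl
      ; sym   = λ (x , y) → sym x , sym y
      ; trans = λ (x , y) (x′ , y′) → trans x x′ , trans y y′
      }
    ; _≟_ = _∼₂?_
    }
  }

representatives : ∀ n → List (Word n)
representatives n = deduplicate _∼₂?_ (words n)

representative : ∀ {n} {w : Word n} → w ∈ words n → ∃[ u ] u ∈ representatives n × w ∼₂ u
representative {n} {w} w∈ = find (Setoid.∈-deduplicate⁺ ≈.setoid _∼₂?_
  (λ {x} {y} {z} z∼y x∼y → ≈.trans {x} {y} {z} x∼y (≈.sym {z} {y} z∼y)) {z = w}
  (Any.map {Q = w ∼₂_} (λ { refl → ≈.refl {w} }) w∈))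
  where module ≈ = DecSetoid (∼₂-decSetoid n)

-- Finite sums and indicators

∑ : ℕ → (ℕ → ℕ) → ℕ
∑ n f = sum (applyUpTo f n)

χ : ∀ {P : Set} → Dec P → ℕ
χ P? = if does P? then 1 else 0

χ-yes : ∀ {P : Set} (P? : Dec P) → P → χ P? ≡ 1
χ-yes (yes _) _ = refl
χ-yes (no ¬P) P = contradiction P ¬P

χ-no : ∀ {P : Set} (P? : Dec P) → ¬ P → χ P? ≡ 0
χ-no (yes P) ¬P = contradiction P ¬P
χ-no (no _)  _  = refl

χ-cong : ∀ {P Q : Set} (P? : Dec P) (Q? : Dec Q) → (P → Q) → (Q → P) → χ P? ≡ χ Q?
χ-cong (yes P) Q? P⇒Q _ = sym (χ-yes Q? (P⇒Q P))
χ-cong (no ¬P) Q? _ Q⇒P = sym (χ-no Q? (¬P ∘ Q⇒P))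

length-filter-∷ : ∀ {A : Set} {P : A → Set} (P? : Unary.Decidable P) x xs →
                  length (filter P? (x ∷ xs)) ≡ χ (P? x) + length (filter P? xs)
length-filter-∷ P? x xs with does (P? x)
... | true  = refl
... | false = refl

length-filter-applyUpTo : ∀ {P : ℕ → Set} (P? : Unary.Decidable P) f n →
  length (filter P? (applyUpTo f n)) ≡ ∑ n (χ ∘ P? ∘ f)
length-filter-applyUpTo P? f zero    = refl
length-filter-applyUpTo P? f (suc n) = trans (length-filter-∷ P? (f 0) (applyUpTo (f ∘ suc) n))
  (cong (χ (P? (f 0)) +_) (length-filter-applyUpTo P? (f ∘ suc) n))

∑-cong : ∀ n {f g} → (∀ {i} → i < n → f i ≡ g i) → ∑ n f ≡ ∑ n g
∑-cong zero    f≗g = refl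
∑-cong (suc n) f≗g = cong₂ _+_ (f≗g (s≤s z≤n)) (∑-cong n (f≗g ∘ s≤s))

∑-const : ∀ n {f d} → (∀ {i} → i < n → f i ≡ d) → ∑ n f ≡ n * d
∑-const zero    f≗d = refl
∑-const (suc n) f≗d = cong₂ _+_ (f≗d (s≤s z≤n)) (∑-const n (f≗d ∘ s≤s))

∑-zero : ∀ n {f} → (∀ {i} → i < n → f i ≡ 0) → ∑ n f ≡ 0
∑-zero n f≗0 = trans (∑-const n f≗0) (*-zeroʳ n)

∑-+ : ∀ n f g → ∑ n (λ i → f i + g i) ≡ ∑ n f + ∑ n g
∑-+ zero    f g = refl
∑-+ (suc n) f g = trans (cong (f 0 + g 0 +_) (∑-+ n (f ∘ suc) (g ∘ suc)))
  (interchange (f 0) (g 0) (∑ n (f ∘ suc)) (∑ n (g ∘ suc)))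
  where
  interchange : ∀ w x y z → w + x + (y + z) ≡ w + y + (x + z)
  interchange = solve-∀

∑-* : ∀ d n f → ∑ n (λ i → d * f i) ≡ d * ∑ n f
∑-* d zero    f = sym (*-zeroʳ d)
∑-* d (suc n) f = trans (cong (d * f 0 +_) (∑-* d n (f ∘ suc))) (sym (*-distribˡ-+ d (f 0) _))

∑-split : ∀ m n f → ∑ (m + n) f ≡ ∑ m f + ∑ n (λ i → f (m + i))
∑-split zero    n f = refl
∑-split (suc m) n f = trans (cong (f 0 +_) (∑-split m n (f ∘ suc))) (sym (+-assoc (f 0) _ _))

-- Relating `i` and `j` by `suc (i + j) ≡ n` keeps subtraction out of the summands.
∑-reverse : ∀ n {f g} → (∀ {i j} → suc (i + j) ≡ n → f i ≡ g j) → ∑ n f ≡ ∑ n g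
∑-reverse zero    _ = refl
∑-reverse (suc n) {f} {g} f≡g = begin
  f 0 + ∑ n (f ∘ suc)         ≡⟨ cong₂ _+_ (f≡g refl) (∑-reverse n (f≡g ∘ cong suc)) ⟩
  g n + ∑ n g                 ≡⟨ +-comm (g n) _ ⟩
  ∑ n g + g n                 ≡⟨ cong (∑ n g +_) (trans (cong g (sym (+-identityʳ n))) (sym (+-identityʳ _))) ⟩
  ∑ n g + ∑ 1 (λ i → g (n + i)) ≡⟨ ∑-split n 1 g ⟨
  ∑ (n + 1) g                 ≡⟨ cong (λ l → ∑ l g) (+-comm n 1) ⟩
  ∑ (suc n) g                 ∎
  where open ≡-Reasoning

-- Applied twice: to the coefficients of one box, with `d` equal to 0, and to the rows of all `k`,
-- with `d` equal to `2 * ε K`.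
∑-palindrome : ∀ s t {f d} → (∀ {j} → j < t → f (s + j) ≡ d) →
               (∀ {i j} → suc (i + j) ≡ s + t + s → f i ≡ f j) →
               ∑ (s + t + s) f ≡ 2 * ∑ s f + t * d
∑-palindrome s t {f} {d} middle symmetric = begin
  ∑ (s + t + s) f
    ≡⟨ ∑-split (s + t) s f ⟩
  ∑ (s + t) f + ∑ s (λ i → f (s + t + i))
    ≡⟨ cong₂ _+_ (∑-split s t f) (∑-reverse s {g = f} λ {i} {j} eq → symmetric
         (trans (cong suc (+-assoc (s + t) i j))
           (trans (sym (+-suc (s + t) (i + j))) (cong (s + t +_) eq)))) ⟩
  ∑ s f + ∑ t (λ i → f (s + i)) + ∑ s f
    ≡⟨ cong (λ x → ∑ s f + x + ∑ s f) (∑-const t middle) ⟩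
  ∑ s f + t * d + ∑ s f
    ≡⟨ rearrange (∑ s f) (t * d) ⟩
  2 * ∑ s f + t * d ∎
  where
  open ≡-Reasoning
  rearrange : ∀ x y → x + y + x ≡ 2 * x + y
  rearrange = solve-∀

∑-indicator : ∀ {m n} → m < n → ∑ n (λ k → χ (m ≟ k)) ≡ 1
∑-indicator {zero}  {suc n} _ = cong suc (∑-zero n λ {i} _ → χ-no (0 ≟ suc i) λ ())
∑-indicator {suc m} {suc n} (s≤s m<n) = trans
  (cong₂ _+_ (χ-no (suc m ≟ 0) λ ())
    (∑-cong n λ {k} _ → χ-cong (suc m ≟ suc k) (m ≟ k) suc-injective (cong suc)))
  (∑-indicator m<n)

length-fibres : ∀ {A : Set} (f : A → ℕ) {n} → (∀ x → f x < n) → ∀ xs →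
                length xs ≡ ∑ n (λ k → length (filter (λ x → f x ≟ k) xs))
length-fibres f {n} f< []       = sym (∑-zero n λ _ → refl)
length-fibres f {n} f< (x ∷ xs) = begin
  1 + length xs
    ≡⟨ cong₂ _+_ (sym (∑-indicator (f< x))) (length-fibres f f< xs) ⟩
  ∑ n (λ k → χ (f x ≟ k)) + ∑ n (λ k → length (filter (λ x → f x ≟ k) xs))
    ≡⟨ ∑-+ n (λ k → χ (f x ≟ k)) _ ⟨
  ∑ n (λ k → χ (f x ≟ k) + length (filter (λ x → f x ≟ k) xs))
    ≡⟨ ∑-cong n (λ {k} _ → sym (length-filter-∷ (λ x → f x ≟ k) x xs)) ⟩
  ∑ n (λ k → length (filter (λ x → f x ≟ k) (x ∷ xs))) ∎
  where open ≡-Reasoning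

-- Counting the solutions

-- The number of classes of size K of words with k letters a and m letters b.
row : ℕ → ℕ → ℕ → ℕ
row K k m = ∑ (suc (k * m)) (λ q → χ (gauss k m q ≟ K))

row-comm : ∀ K k m → row K k m ≡ row K m k
row-comm K k m = trans (cong (λ l → ∑ (suc l) (λ q → χ (gauss k m q ≟ K))) (*-comm k m))
  (∑-cong (suc (m * k)) λ {q} _ → cong (λ g → χ (g ≟ K)) (gauss-comm k m q))

-- For a fixed number of letters `a` a class is determined by its number of `ab`, so representatives
-- may be counted by that number.
#ab-unique : ∀ {n k} {ws : List (Word n)} → All (λ w → #a w ≡ k) ws →
             AllPairs (λ u w → ¬ u ∼₂ w) ws → Unique (map #ab ws)
#ab-unique []         []           = []
#ab-unique (eq ∷ eqs) (≁ws ∷ ws≁) =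
  All.map⁺ (All.zipWith (λ (eq′ , ≁w) ab≡ → ≁w (trans eq (sym eq′) , ab≡)) (eqs , ≁ws))
  ∷ #ab-unique eqs ws≁

-- Classes are sorted by `#a` and identified with values of `#ab`. Because `K` is positive, a
-- coefficient equal to `K` lies at an index at most `k * m` and is realised by a word.
N-rows : ∀ {K n} → 1 ≤ K → N K n ≡ ∑ (suc n) (λ k → row K k (n ∸ k))
N-rows {K} {n} 1≤K = trans
  (length-fibres #a (λ w → s≤s (≤-trans (m≤m+n (#a w) (#b w)) (≤-reflexive (#a+#b w)))) classes)
  (∑-cong (suc n) λ {k} k<1+n → fibre k (n ∸ k) (m+[n∸m]≡n (s≤s⁻¹ k<1+n)))
  where
  size? = λ (w : Word n) → classSize w ≟ K
  classes = filter size? (representatives n)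

  fibre : ∀ k m → k + m ≡ n → length (filter (λ w → #a w ≟ k) classes) ≡ row K k m
  fibre k m k+m≡n = begin
    length ws
      ≡⟨ List.length-map #ab ws ⟨
    length (map #ab ws)
      ≡⟨ length-unique
           (#ab-unique (All.all-filter a? classes)
             (AllPairs.filter⁺ a? (AllPairs.filter⁺ size?
               (UniqueDecSetoid.deduplicate-! (∼₂-decSetoid n) (words n)))))
           (Unique.filter⁺ g? (Unique.upTo⁺ (suc (k * m))))
           (mk⇔ to from) ⟩
    length (filter g? (upTo (suc (k * m))))
      ≡⟨ length-filter-applyUpTo g? (λ i → i) (suc (k * m)) ⟩
    row K k m ∎
    where
    open ≡-Reasoning
    a? = λ (w : Word n) → #a w ≟ k
    g? = λ q → gauss k m q ≟ K
    ws = filter a? classes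

    to : ∀ {q} → q ∈ map #ab ws → q ∈ filter g? (upTo (suc (k * m)))
    to q∈ with ∈-map⁻ #ab q∈
    ... | w , w∈ , refl with ∈-filter⁻ a? {xs = classes} w∈
    ...   | w∈′ , #a≡ with ∈-filter⁻ size? {xs = representatives n} w∈′
    ...     | _ , size≡ = ∈-filter⁺ g? (∈-upTo⁺ (≰⇒> λ large →
      contradiction (trans (sym g≡K) (gauss-large k m (#ab w) large)) (>⇒≢ 1≤K))) g≡K
      where g≡K = trans (sym (classSize-gauss w #a≡ k+m≡n)) size≡

    from : ∀ {q} → q ∈ filter g? (upTo (suc (k * m))) → q ∈ map #ab ws
    from {q} q∈ with ∈-filter⁻ g? {xs = upTo (suc (k * m))} q∈
    ... | _ , g≡K with word-exists {k = k} {m} {q} k+m≡n (subst (1 ≤_) (sym g≡K) 1≤K)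
    ...   | w , w∈ , #a≡ , #ab≡ with representative w∈
    ...     | u , u∈ , #a∼ , #ab∼ = subst (_∈ map #ab ws) (trans (sym #ab∼) #ab≡)
      (∈-map⁺ #ab (∈-filter⁺ a? (∈-filter⁺ size? u∈ size≡) #a≡k))
      where
      #a≡k = trans (sym #a∼) #a≡
      size≡ = trans (classSize-gauss u #a≡k k+m≡n)
        (trans (cong (gauss k m) (trans (sym #ab∼) #ab≡)) g≡K)

-- The central coefficients exceed `K` by `plateau`. The `s` lowest ones agree with `p≤ k`, and the
-- `s` highest ones mirror them.
row-threshold : ∀ {K k m s} → 2 ≤ k → s ≤ m → K < p≤ k s →
                row K k m ≡ 2 * ∑ s (λ q → χ (p≤ k q ≟ K))
row-threshold {K} {k} {m} {s} 2≤k s≤m K< with m≤n⇒∃[o]m+o≡n s+s≤k*m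
  where
  s+s≤k*m : s + s ≤ k * m
  s+s≤k*m = ≤-trans (+-mono-≤ s≤m (≤-trans s≤m (m≤m+n m 0))) (*-monoˡ-≤ m 2≤k)
... | d , s+s+d≡ = begin
  ∑ (suc (k * m)) f
    ≡⟨ cong (λ l → ∑ l f) size ⟩
  ∑ (s + suc d + s) f
    ≡⟨ ∑-palindrome s (suc d)
         (λ {j} j≤d → χ-no (gauss k m (s + j) ≟ K) (>⇒≢ (≤-trans K<gauss
           (plateau m 2≤k s≤m (m≤m+n s j) (centre (s≤s⁻¹ j≤d))))))
         (λ {i} {j} eq → cong (λ g → χ (g ≟ K))
           (gauss-mirror k m {i} {j} (suc-injective (trans eq (sym size))))) ⟩
  2 * ∑ s f + suc d * 0
    ≡⟨ cong (2 * ∑ s f +_) (*-zeroʳ (suc d)) ⟩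
  2 * ∑ s f + 0
    ≡⟨ +-identityʳ _ ⟩
  2 * ∑ s f
    ≡⟨ cong (2 *_) (∑-cong s λ q<s →
         cong (λ g → χ (g ≟ K)) (sym (p≤-gauss k (≤-trans (<⇒≤ q<s) s≤m)))) ⟩
  2 * ∑ s (λ q → χ (p≤ k q ≟ K)) ∎
  where
  open ≡-Reasoning
  f = λ q → χ (gauss k m q ≟ K)

  K<gauss : K < gauss k m s
  K<gauss = subst (K <_) (p≤-gauss k s≤m) K<

  rearrange : ∀ s d → suc (s + s + d) ≡ s + suc d + s
  rearrange = solve-∀

  size : suc (k * m) ≡ s + suc d + s
  size = trans (cong suc (sym s+s+d≡)) (rearrange s d)

  centre : ∀ {j} → j ≤ d → s + j + s ≤ k * m
  centre {j} j≤d = linear-≤ 0 (+-mono-≤ j≤d (≤-reflexive s+s+d≡)) (balance s j d (k * m))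
    where
    balance : ∀ s j d x → s + j + s + (d + x) + 0 ≡ x + (j + (s + s + d))
    balance = solve-∀

-- `solutions` searches below `K + K`. By `p≤-mono` no solution reaches `s`, so searching below `s`
-- finds the same ones.
c-sum : ∀ {K r s} → 2 ≤ r → K < p≤ r s → c K r ≡ ∑ s (λ q → χ (p≤ r q ≟ K))
c-sum {K} {r} {s} 2≤r K< = trans
  (length-unique (Unique.filter⁺ p? (Unique.upTo⁺ (K + K))) (Unique.filter⁺ p? (Unique.upTo⁺ s))
    (mk⇔ to from))
  (length-filter-applyUpTo p? (λ i → i) s)
  where
  p? = λ ξ → p≤ r ξ ≟ K
  to : ∀ {ξ} → ξ ∈ solutions K r → ξ ∈ filter p? (upTo s)
  to {ξ} ξ∈ = ∈-filter⁺ p? {xs = upTo s}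
    (∈-upTo⁺ (≰⇒> λ s≤ξ → <⇒≢ (≤-trans K< (p≤-mono 2≤r s≤ξ)) (sym eq))) eq
    where eq = Equivalence.to (∈-solutions {K} {r} {ξ} 2≤r) ξ∈
  from : ∀ {ξ} → ξ ∈ filter p? (upTo s) → ξ ∈ solutions K r
  from {ξ} ξ∈ = Equivalence.from (∈-solutions {K} {r} {ξ} 2≤r)
    (proj₂ (∈-filter⁻ p? {xs = upTo s} ξ∈))

-- Consequences of the choice of the constants

p-above-ρ : ∀ K → K < p (ρ K)
p-above-ρ K = proj₁ (proj₂ (ρ-least K))

-- Places 2 in `range K` and makes `ρ K ∸ 2` exact.
ρ≥3 : ∀ {K} → 2 ≤ K → 3 ≤ ρ K
ρ≥3 {K} 2≤K = ≰⇒> λ ρ≤2 → contradiction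
  (≤-trans (s≤s 2≤K) (p-above-ρ K)) (≤⇒≯ (small ρ≤2))
  where
  small : ∀ {ξ} → ξ ≤ 2 → p ξ ≤ 2
  small z≤n             = s≤s z≤n
  small (s≤s z≤n)       = s≤s z≤n
  small (s≤s (s≤s z≤n)) = ≤-refl

-- A value `K ≥ 2` is taken by `p` at most once, and only before `ρ K` because `p` is monotone.
ε-sum : ∀ {K} → 2 ≤ K → ∑ (ρ K) (λ q → χ (p q ≟ K)) ≡ ε K
ε-sum {K} 2≤K = go (value? K)
  where
  go : (v : Dec (∃[ ξ ] p ξ ≡ K)) → ∑ (ρ K) (λ q → χ (p q ≟ K)) ≡ χ v
  go (no ∄ξ) = ∑-zero (ρ K) λ {q} _ → χ-no (p q ≟ K) (λ eq → ∄ξ (q , eq))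
  go (yes (ξ , refl)) = trans
    (∑-cong (ρ (p ξ)) λ {q} _ → χ-cong (p q ≟ p ξ) (ξ ≟ q)
      (λ eq → p-injective 2≤K (sym eq)) (λ { refl → refl }))
    (∑-indicator ξ<ρ)
    where
    ξ<ρ : ξ < ρ (p ξ)
    ξ<ρ = ≰⇒> λ ρ≤ξ → contradiction (p-above-ρ (p ξ)) (≤⇒≯ (p-mono ρ≤ξ))
      where
      p-mono : ∀ {i} → i ≤ ξ → p i ≤ p ξ
      p-mono i≤ξ with m≤n⇒m<n∨m≡n i≤ξ
      ... | inj₁ i<ξ  = <⇒≤ (p-strict 2≤K i<ξ)
      ... | inj₂ refl = ≤-refl

∈-mapMaybe : ∀ {A B : Set} (f : A → Maybe B) {x y xs} → x ∈ xs → f x ≡ just y → y ∈ mapMaybe f xs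
∈-mapMaybe f {x} {y} {xs} x∈ fx≡ =
  Any.mapMaybe⁺ f xs (Any.map⁺ (lose x∈ (subst (λ z → AnyMaybe.Any (y ≡_) z) (sym fx≡) (AnyMaybe.just refl))))

≤-τ : ∀ K r {ξ} → ξ ∈ solutions K r → ∃[ t ] τ K r ≡ just t × ξ ≤ t
≤-τ K r ξ∈ with solutions K r
≤-τ K r (here refl) | ζ ∷ ζs = max ζ ζs , refl , ⊥≤max ζ ζs
≤-τ K r (there ξ∈)  | ζ ∷ ζs = max ζ ζs , refl , All.lookup (xs≤max ζ ζs) ξ∈

candidate : ℕ → ℕ → Maybe ℕ
candidate K r = Maybe.map (λ t → r + t + 1) (τ K r)

-- Comes from the first term of the maximum.
2ρ≤ : ∀ {K n} → n₀ K ≤ n → 2 * ρ K ≤ suc n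
2ρ≤ {K} {n} n₀≤n = ≤-trans (m≤n+m∸n (2 * ρ K) 1)
  (s≤s (≤-trans (⊥≤max (2 * ρ K ∸ 1) (mapMaybe (candidate K) (range K))) n₀≤n))

-- The term r = 2 of n₀ is 2K + 2, because p≤ 2 ξ = ⌊ξ/2⌋ + 1.
2+2K≤ : ∀ {K n} → 2 ≤ K → n₀ K ≤ n → 2 + (K + K) ≤ n
2+2K≤ {K@(suc K′)} {n} 2≤K n₀≤n = from-τ
  -- The witness `suc (K′ + K′)` is `2 * K ∸ 1`, the largest `ξ` with `suc ⌊ ξ /2⌋ ≡ K`.
  (≤-τ K 2 (Equivalence.from (∈-solutions {K} {2} {suc (K′ + K′)} ≤-refl) value))
  where
  value : p≤ 2 (suc (K′ + K′)) ≡ K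
  value = trans (p≤-gauss 2 {suc (K′ + K′)} ≤-refl)
    (trans (gauss-two {suc (K′ + K′)} ≤-refl) (cong suc (sym (n≡⌈n+n/2⌉ K′))))

  rearrange : ∀ K′ → 2 + (suc K′ + suc K′) ≡ 2 + suc (K′ + K′) + 1
  rearrange = solve-∀

  from-τ : ∃[ t ] τ K 2 ≡ just t × suc (K′ + K′) ≤ t → 2 + (K + K) ≤ n
  from-τ (t , τ≡ , ≤t) = ≤-trans
    (≤-trans (≤-reflexive (rearrange K′)) (+-monoˡ-≤ 1 (+-monoʳ-≤ 2 ≤t)))
    (≤-trans (All.lookup (xs≤max (2 * ρ K ∸ 1) (mapMaybe (candidate K) (range K)))
      (∈-mapMaybe (candidate K) (∈-map⁺ (2 +_) (∈-upTo⁺ (m<n⇒0<n∸m (ρ≥3 2≤K))))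
        (cong (Maybe.map (λ t → 2 + t + 1)) τ≡)))
      n₀≤n)

-- Evaluation of the rows

row-zero : ∀ {K} m → 2 ≤ K → row K 0 m ≡ 0
row-zero {K} m 2≤K = ∑-zero 1 λ {q} q<1 → χ-no (δ₀ q ≟ K) (<⇒≢ (≤-trans (s≤s (δ₀≤1 q)) 2≤K))
  where
  δ₀≤1 : ∀ q → δ₀ q ≤ 1
  δ₀≤1 zero    = ≤-refl
  δ₀≤1 (suc q) = z≤n

row-one : ∀ {K} m → 2 ≤ K → row K 1 m ≡ 0
row-one {K} m 2≤K = ∑-zero (suc (1 * m)) λ {q} q≤ → χ-no (gauss 1 m q ≟ K)
  (<⇒≢ (≤-trans (≤-reflexive (cong suc (gauss-one
    (≤-trans (s≤s⁻¹ q≤) (≤-reflexive (*-identityˡ m)))))) 2≤K))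

row-small : ∀ {K r m} → 2 ≤ r → r ≤ m → 2 + (K + K) ≤ r + m → row K r m ≡ 2 * c K r
row-small {m = m} 2≤r r≤m 2K≤ =
  trans (row-threshold 2≤r ≤-refl K<) (cong (2 *_) (sym (c-sum {s = m} 2≤r K<)))
  where K< = p≤-big 2≤r r≤m 2K≤

-- At indices up to `ρ K ≤ k` the bound on the number of parts is void as well, so `p≤ k` is `p`
-- there.
row-large : ∀ {K k m} → 2 ≤ K → ρ K ≤ k → ρ K ≤ m → row K k m ≡ 2 * ε K
row-large {K} {k} 2≤K ρ≤k ρ≤m = trans
  (row-threshold (≤-trans (≤-trans (n≤1+n 2) (ρ≥3 2≤K)) ρ≤k) ρ≤m
    (subst (K <_) (sym (p≤-all ρ≤k)) (p-above-ρ K)))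
  (cong (2 *_) (trans
    (∑-cong (ρ K) λ q<ρ → cong (λ x → χ (x ≟ K)) (p≤-all (≤-trans (<⇒≤ q<ρ) ρ≤k)))
    (ε-sum 2≤K)))

theorem4 : ∀ (K n : ℕ) → 2 ≤ K → n₀ K ≤ n →
    N K n ≡ 2 * ε K * ((n + 1) ∸ 2 * ρ K) + 4 * sum (map (c K) (range K))
theorem4 K n 2≤K n₀≤n = begin
  N K n
    ≡⟨ N-rows {n = n} (≤-trans (n≤1+n 1) 2≤K) ⟩
  ∑ (suc n) F
    -- The `n + 1` values of `k` fall into `ρ K` low ones, `t` middle ones and `ρ K` high ones;
    -- `row-comm` mirrors the high rows to the low ones.
    ≡⟨ cong (λ l → ∑ l F) size ⟩
  ∑ (ρ K + t + ρ K) F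
    ≡⟨ ∑-palindrome (ρ K) t middle (λ {i} {j} → symmetric {i} {j}) ⟩
  2 * ∑ (ρ K) F + t * (2 * ε K)
    ≡⟨ cong (λ x → 2 * x + t * (2 * ε K)) small ⟩
  2 * (2 * ∑ r (λ i → c K (2 + i))) + t * (2 * ε K)
    ≡⟨ rearrange (∑ r (λ i → c K (2 + i))) t (ε K) ⟩
  2 * ε K * t + 4 * ∑ r (λ i → c K (2 + i))
    ≡⟨ cong (λ x → 2 * ε K * t + 4 * x) (sym range-sum) ⟩
  2 * ε K * t + 4 * sum (map (c K) (range K)) ∎
  where
  open ≡-Reasoning
  r = ρ K ∸ 2
  t = (n + 1) ∸ 2 * ρ K

  2+r≡ : 2 + r ≡ ρ K
  2+r≡ = m+[n∸m]≡n (≤-trans (n≤1+n 2) (ρ≥3 2≤K))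

  2ρ+t≡ : 2 * ρ K + t ≡ suc n
  2ρ+t≡ = trans (m+[n∸m]≡n (≤-trans (2ρ≤ {K} n₀≤n) (≤-reflexive (+-comm 1 n)))) (+-comm n 1)

  F : ℕ → ℕ
  F k = row K k (n ∸ k)

  F≡ : ∀ {k m} → k + m ≡ n → F k ≡ row K k m
  F≡ {k} {m} refl = cong (row K k) (m+n∸m≡n k m)

  size : suc n ≡ ρ K + t + ρ K
  size = trans (sym 2ρ+t≡) (double (ρ K) t)
    where
    double : ∀ x y → 2 * x + y ≡ x + y + x
    double = solve-∀

  symmetric : ∀ {i j} → suc (i + j) ≡ ρ K + t + ρ K → F i ≡ F j
  symmetric {i} {j} eq = trans (F≡ {i} {j} i+j≡n)
    (trans (row-comm K i j) (sym (F≡ {j} {i} (trans (+-comm j i) i+j≡n))))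
    where i+j≡n = suc-injective (trans eq (sym size))

  middle : ∀ {j} → j < t → F (ρ K + j) ≡ 2 * ε K
  -- Here `k` is `ρ K + j` and `m` is `o + ρ K`, so both reach `ρ K`.
  middle {j} j<t = trans (F≡ {ρ K + j} {o + ρ K} (suc-injective (trans (regroup (ρ K) j o)
      (trans (cong (λ t → ρ K + t + ρ K) 1+j+o≡t) (sym size)))))
    (row-large 2≤K (m≤m+n (ρ K) j) (m≤n+m (ρ K) o))
    where
    o = t ∸ suc j
    1+j+o≡t : suc j + o ≡ t
    1+j+o≡t = m+[n∸m]≡n j<t
    regroup : ∀ x j o → suc (x + j + (o + x)) ≡ x + (suc j + o) + x
    regroup = solve-∀

  ith : ∀ {i} → i < r → F (2 + i) ≡ 2 * c K (2 + i)
  ith {i} i<r = trans (F≡ {2 + i} {2 + i + o} sum≡n)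
    (row-small (s≤s (s≤s z≤n)) (m≤m+n (2 + i) o)
      (≤-trans (2+2K≤ 2≤K n₀≤n) (≤-reflexive (sym sum≡n))))
    where
    fits : 2 + i + (3 + i) ≤ ρ K + t + ρ K
    fits = linear-≤ (1 + t)
      (+-mono-≤ (+-mono-≤ i<r i<r) (+-mono-≤ (≤-reflexive 2+r≡) (≤-reflexive 2+r≡)))
      (balance i r (ρ K) t)
      where
      balance : ∀ i r x t → 2 + i + (3 + i) + (r + r + (x + x)) + (1 + t) ≡
                            x + t + x + (suc i + suc i + (2 + r + (2 + r)))
      balance = solve-∀
    -- With `k = 2 + i` this is `n ∸ 2 * k`, exact by `fits`; it gives `m = k + o` and hence
    -- `k ≤ m`.
    o = suc n ∸ (2 + i + (3 + i))
    eq : 2 + i + (3 + i) + o ≡ suc n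
    eq = m+[n∸m]≡n (≤-trans fits (≤-reflexive (sym size)))
    regroup : ∀ i o → suc (2 + i + (2 + i + o)) ≡ 2 + i + (3 + i) + o
    regroup = solve-∀
    sum≡n : 2 + i + (2 + i + o) ≡ n
    sum≡n = suc-injective (trans (regroup i o) eq)

  small : ∑ (ρ K) F ≡ 2 * ∑ r (λ i → c K (2 + i))
  small = begin
    ∑ (ρ K) F
      ≡⟨ cong (λ l → ∑ l F) (sym 2+r≡) ⟩
    F 0 + (F 1 + ∑ r (λ i → F (2 + i)))
      ≡⟨ cong₂ (λ x y → x + (y + ∑ r (λ i → F (2 + i))))
           (row-zero {K} n 2≤K) (row-one {K} (n ∸ 1) 2≤K) ⟩
    ∑ r (λ i → F (2 + i))
      ≡⟨ ∑-cong r ith ⟩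
    ∑ r (λ i → 2 * c K (2 + i))
      ≡⟨ ∑-* 2 r (λ i → c K (2 + i)) ⟩
    2 * ∑ r (λ i → c K (2 + i)) ∎

  rearrange : ∀ x t e → 2 * (2 * x) + t * (2 * e) ≡ 2 * e * t + 4 * x
  rearrange = solve-∀

  range-sum : sum (map (c K) (range K)) ≡ ∑ r (λ i → c K (2 + i))
  range-sum = cong sum (trans (sym (List.map-∘ (upTo (ρ K ∸ 2))))
    (List.map-upTo (λ i → c K (2 + i)) r))
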